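{- Let $q$ be odd, $P$ an internal point and $\ell=P^\perp$. Let $Q$ be an external point on $\ell$ and $\ell^*$ a tangent line through $Q$. Let $P_1\neq P_2$ be two external points on $\ell^*$, and for $i=1,2$ let $\ell_i$ be the tangent line through $P_i$ different from $\ell^*$. Then $\ell_1$ and $\ell_2$ meet in an external point lying on a secant line through $P$ if and only if one of the following holds: (i) the lines $PP_1$ and $PP_2$ are both passant lines; (ii) the lines $PP_1$ and $PP_2$ are both secant lines.
   Context: $\mathrm{PG}(2,q)$ has points $(a_0,a_1,a_2)$ and lines $[b_0,b_1,b_2]$ with incidence $a_0b_0+a_1b_1+a_2b_2=0$. The conic is $\mathcal{O}=\{(1,t,t^2):t\in\mathbb{F}_q\}\cup\{(0,0,1)\}$. A line is passant/tangent/secant if it meets $\mathcal{O}$ in $0/1/2$ points. A point not on $\mathcal{O}$ is external (resp. internal) if it lies on $2$ (resp. $0$) tangent lines. The polarity $\perp$ maps the point $(x,y,z)$ to the line $[z,-2y,x]$. -}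

module Defs where

open import Level using (0ℓ)
open import Data.Nat using (ℕ)
open import Data.Fin using (Fin)
open import Data.Product using (Σ; ∃; _×_; _,_)
open import Data.Sum using (_⊎_)
open import Relation.Nullary using (¬_)
open import Relation.Binary.PropositionalEquality using (_≡_; _≢_)
open import Relation.Binary.Definitions using (DecidableEquality)
open import Algebra.Structures using (IsCommutativeRing)
open import Function.Bundles using (_↔_)

record FiniteField (q : ℕ) : Set₁ where
  infixl 6 _+_
  infixl 7 _*_
  field
    Carrier   : Set
    _+_ _*_   : Carrier → Carrier → Carrier
    -_        : Carrier → Carrier
    0# 1#     : Carrier
    isCommutativeRing : IsCommutativeRing _≡_ _+_ _*_ -_ 0# 1#
    _≟_       : DecidableEquality Carrier
    0≢1       : 0# ≢ 1#
    inverse   : ∀ x → x ≢ 0# → Σ Carrier λ y → x * y ≡ 1#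
    enumerate : Fin q ↔ Carrier

module PG2 {q : ℕ} (F : FiniteField q) where
  open FiniteField F

  -- homogeneous coordinate triples (used both for points (a0,a1,a2) and lines [b0,b1,b2])
  record Triple : Set where
    constructor ⟨_,_,_⟩
    field
      c₀ c₁ c₂ : Carrier
  open Triple public

  NonZero : Triple → Set
  NonZero u = ¬ (c₀ u ≡ 0# × c₁ u ≡ 0# × c₂ u ≡ 0#)

  _∼_ : Triple → Triple → Set
  u ∼ v = Σ Carrier λ k → k ≢ 0# × (c₀ v ≡ k * c₀ u × c₁ v ≡ k * c₁ u × c₂ v ≡ k * c₂ u)

  _I_ : Triple → Triple → Set
  p I l = c₀ p * c₀ l + c₁ p * c₁ l + c₂ p * c₂ l ≡ 0#

  OnConic : Triple → Set
  OnConic p = (Σ Carrier λ t → p ∼ ⟨ 1# , t , t * t ⟩) ⊎ (p ∼ ⟨ 0# , 0# , 1# ⟩)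

  -- counting distinct projective objects (nonzero triples up to ∼) satisfying a predicate
  NoneSuch : (Triple → Set) → Set
  NoneSuch X = ∀ w → NonZero w → ¬ X w

  ExactlyOne : (Triple → Set) → Set
  ExactlyOne X = Σ Triple λ u → NonZero u × X u × (∀ w → NonZero w → X w → w ∼ u)

  ExactlyTwo : (Triple → Set) → Set
  ExactlyTwo X = Σ Triple λ u → Σ Triple λ v →
    NonZero u × NonZero v × ¬ (u ∼ v) × X u × X v ×
    (∀ w → NonZero w → X w → w ∼ u ⊎ w ∼ v)

  Passant Tangent Secant : Triple → Set
  Passant l = NoneSuch   (λ p → OnConic p × p I l)
  Tangent l = ExactlyOne (λ p → OnConic p × p I l)
  Secant  l = ExactlyTwo (λ p → OnConic p × p I l)

  External Internal : Triple → Set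
  External p = ¬ OnConic p × ExactlyTwo (λ l → Tangent l × p I l)
  Internal p = ¬ OnConic p × NoneSuch   (λ l → Tangent l × p I l)

  _⊥ : Triple → Triple
  ⟨ x , y , z ⟩ ⊥ = ⟨ z , - ((1# + 1#) * y) , x ⟩

  join : Triple → Triple → Triple
  join ⟨ a₀ , a₁ , a₂ ⟩ ⟨ b₀ , b₁ , b₂ ⟩ =
    ⟨ a₁ * b₂ + - (a₂ * b₁) , a₂ * b₀ + - (a₀ * b₂) , a₀ * b₁ + - (a₁ * b₀) ⟩

-- Write every tangent as T(s, t), the polar of the conic point (s², st, t²), and put
-- αᵢ = P·Tᵢ, which is nonzero because P is internal.  The line joining P to the meet
-- Tᵢ × Tⱼ of two tangents has discriminant αᵢαⱼ(2 det)², and a line is secant or passant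
-- according as its discriminant is a nonzero square or a non-square.  Since P₁ = T₀ × T₁,
-- P₂ = T₀ × T₂ and R must be T₁ × T₂ (always an external point), the three lines PP₁, PP₂,
-- PR are governed by the square classes of α₀α₁, α₀α₂ and α₁α₂; and α₁α₂ is a square
-- exactly when α₀α₁ and α₀α₂ lie in the same class, because in a finite field the product
-- of two non-squares is a square.
module Submission where

open import Defs
open import Algebra.Bundles using (CommutativeRing; RawRing)
open import Data.Empty using (⊥-elim)
open import Data.Fin.Base using (Fin; punchOut)
import Data.Fin.Properties as Fin
open import Data.Nat using (ℕ; _%_)
import Data.Nat.Base as ℕ
import Data.Nat.Properties as ℕ
open import Data.Product using (Σ; ∃; _×_; _,_; proj₁; proj₂)
open import Data.Sum using (_⊎_)
open import Function.Bundles using (_⇔_)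
open import Relation.Nullary using (¬_; yes; no)
open import Relation.Binary.PropositionalEquality as ≡ using (_≡_; _≢_)

-- Tactic.RingSolver.NonReflective takes its coefficients from the ring itself, whose
-- equality does not compute for an abstract field; here they are integers instead,
-- interpreted through the canonical map ℤ → R.
module IntegerCoefficientSolver {c ℓ} (R : CommutativeRing c ℓ) where
  open import Data.Bool.Base using (Bool; true; false; T)
  open import Data.Integer.Base as ℤ using (ℤ; +_; -[1+_]; _⊖_; _◃_; sign; ∣_∣)
  import Data.Integer.Properties as ℤ
  open import Data.Maybe.Base using (nothing)
  open import Data.Nat.Base as ℕ using (zero; suc)
  open import Data.Sign.Base as Sign using (Sign)
  open import Data.Vec.Base using (Vec)
  open import Data.Vec.N-ary using (N-ary; Eq; Eqʰ; curryⁿ)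
  import Tactic.RingSolver.Core.AlmostCommutativeRing as ACR
  open import Tactic.RingSolver.Core.Polynomial.Parameters using (Homomorphism)
  open import Tactic.RingSolver.Core.Expression public

  open CommutativeRing R
  open import Algebra.Properties.Ring ring using (-1*x≈-x; -‿involutive)
  open import Algebra.Properties.AbelianGroup +-abelianGroup using (⁻¹-∙-comm)
  open import Algebra.Properties.Semiring.Mult.TCOptimised semiring
    using (×-homo-+; ×1-homo-*) renaming (_×_ to _×′_)
  open import Relation.Binary.Reasoning.Setoid setoid

  -- The optimised multiple makes ⟦ + 1 ⟧ and ⟦ + 2 ⟧ reduce to 1# and 1# + 1#,
  -- so that constants in solver equations match the terms written in goals.
  ⟦_⟧ℤ : ℤ → Carrier
  ⟦ + n      ⟧ℤ = n ×′ 1#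
  ⟦ -[1+ n ] ⟧ℤ = - (suc n ×′ 1#)

  private
    -0#≈0# : - 0# ≈ 0#
    -0#≈0# = trans (sym (+-identityˡ (- 0#))) (-‿inverseʳ 0#)

    suc×1 : ∀ n → suc n ×′ 1# ≈ 1# + n ×′ 1#
    suc×1 n = ×-homo-+ 1# 1 n

    ⟦⟧ℤ-⊖ : ∀ m n → ⟦ m ⊖ n ⟧ℤ ≈ m ×′ 1# - n ×′ 1#
    ⟦⟧ℤ-⊖ m zero = begin
      m ×′ 1#        ≈⟨ +-identityʳ _ ⟨
      m ×′ 1# + 0#   ≈⟨ +-congˡ -0#≈0# ⟨
      m ×′ 1# - 0#   ∎
    ⟦⟧ℤ-⊖ zero (suc n) = sym (+-identityˡ _)
    ⟦⟧ℤ-⊖ (suc m) (suc n) = begin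
      ⟦ suc m ⊖ suc n ⟧ℤ                ≡⟨ ≡.cong ⟦_⟧ℤ (ℤ.[1+m]⊖[1+n]≡m⊖n m n) ⟩
      ⟦ m ⊖ n ⟧ℤ                        ≈⟨ ⟦⟧ℤ-⊖ m n ⟩
      m ×′ 1# - n ×′ 1#                 ≈⟨ cancel 1# (m ×′ 1#) (n ×′ 1#) ⟨
      (1# + m ×′ 1#) - (1# + n ×′ 1#)   ≈⟨ +-cong (suc×1 m) (-‿cong (suc×1 n)) ⟨
      suc m ×′ 1# - suc n ×′ 1#         ∎
      where
      cancel : ∀ x y z → (x + y) - (x + z) ≈ y - z
      cancel x y z = begin
        (x + y) - (x + z)       ≈⟨ +-congˡ (⁻¹-∙-comm x z) ⟨
        (x + y) + (- x + - z)   ≈⟨ +-assoc x y (- x + - z) ⟩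
        x + (y + (- x + - z))   ≈⟨ +-congˡ (+-assoc y (- x) (- z)) ⟨
        x + ((y + - x) + - z)   ≈⟨ +-congˡ (+-congʳ (+-comm y (- x))) ⟩
        x + ((- x + y) + - z)   ≈⟨ +-congˡ (+-assoc (- x) y (- z)) ⟩
        x + (- x + (y - z))     ≈⟨ +-assoc x (- x) (y - z) ⟨
        (x - x) + (y - z)       ≈⟨ +-congʳ (-‿inverseʳ x) ⟩
        0# + (y - z)            ≈⟨ +-identityˡ (y - z) ⟩
        y - z                   ∎

    ⟦⟧ℤ-+ : ∀ i j → ⟦ i ℤ.+ j ⟧ℤ ≈ ⟦ i ⟧ℤ + ⟦ j ⟧ℤ
    ⟦⟧ℤ-+ (+ m)      (+ n)      = ×-homo-+ 1# m n
    ⟦⟧ℤ-+ (+ m)      -[1+ n ]   = ⟦⟧ℤ-⊖ m (suc n)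
    ⟦⟧ℤ-+ -[1+ m ]   (+ n)      = trans (⟦⟧ℤ-⊖ n (suc m)) (+-comm _ _)
    ⟦⟧ℤ-+ -[1+ m ]   -[1+ n ]   = begin
      - (suc (suc (m ℕ.+ n)) ×′ 1#)       ≡⟨ ≡.cong (λ k → - (suc k ×′ 1#)) (ℕ.+-suc m n) ⟨
      - ((suc m ℕ.+ suc n) ×′ 1#)         ≈⟨ -‿cong (×-homo-+ 1# (suc m) (suc n)) ⟩
      - (suc m ×′ 1# + suc n ×′ 1#)       ≈⟨ ⁻¹-∙-comm _ _ ⟨
      - (suc m ×′ 1#) + - (suc n ×′ 1#)   ∎

    ⟦⟧ℤ-neg : ∀ i → ⟦ ℤ.- i ⟧ℤ ≈ - ⟦ i ⟧ℤ
    ⟦⟧ℤ-neg (+ zero)  = sym -0#≈0#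
    ⟦⟧ℤ-neg (+ suc n) = refl
    ⟦⟧ℤ-neg -[1+ n ]  = sym (-‿involutive _)

    σ : Sign → Carrier
    σ Sign.+ = 1#
    σ Sign.- = - 1#

    σ-* : ∀ s t → σ (s Sign.* t) ≈ σ s * σ t
    σ-* Sign.+ t      = sym (*-identityˡ _)
    σ-* Sign.- Sign.+ = sym (*-identityʳ _)
    σ-* Sign.- Sign.- = sym (trans (-1*x≈-x (- 1#)) (-‿involutive 1#))

    ⟦⟧ℤ-◃ : ∀ s n → ⟦ s ◃ n ⟧ℤ ≈ σ s * (n ×′ 1#)
    ⟦⟧ℤ-◃ s      zero    = sym (zeroʳ (σ s))
    ⟦⟧ℤ-◃ Sign.+ (suc n) = sym (*-identityˡ _)
    ⟦⟧ℤ-◃ Sign.- (suc n) = sym (-1*x≈-x _)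

    ⟦⟧ℤ-sign : ∀ i → ⟦ i ⟧ℤ ≈ σ (sign i) * (∣ i ∣ ×′ 1#)
    ⟦⟧ℤ-sign i = trans (reflexive (≡.cong ⟦_⟧ℤ (≡.sym (ℤ.◃-inverse i)))) (⟦⟧ℤ-◃ (sign i) ∣ i ∣)

    ⟦⟧ℤ-* : ∀ i j → ⟦ i ℤ.* j ⟧ℤ ≈ ⟦ i ⟧ℤ * ⟦ j ⟧ℤ
    ⟦⟧ℤ-* i j = begin
      ⟦ sign i Sign.* sign j ◃ ∣ i ∣ ℕ.* ∣ j ∣ ⟧ℤ
        ≈⟨ ⟦⟧ℤ-◃ (sign i Sign.* sign j) (∣ i ∣ ℕ.* ∣ j ∣) ⟩
      σ (sign i Sign.* sign j) * ((∣ i ∣ ℕ.* ∣ j ∣) ×′ 1#)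
        ≈⟨ *-cong (σ-* (sign i) (sign j)) (×1-homo-* ∣ i ∣ ∣ j ∣) ⟩
      (σ (sign i) * σ (sign j)) * (∣ i ∣ ×′ 1# * ∣ j ∣ ×′ 1#)
        ≈⟨ interchange _ _ _ _ ⟩
      (σ (sign i) * ∣ i ∣ ×′ 1#) * (σ (sign j) * ∣ j ∣ ×′ 1#)
        ≈⟨ *-cong (⟦⟧ℤ-sign i) (⟦⟧ℤ-sign j) ⟨
      ⟦ i ⟧ℤ * ⟦ j ⟧ℤ
        ∎
      where
      interchange : ∀ a b x y → (a * b) * (x * y) ≈ (a * x) * (b * y)
      interchange a b x y = begin
        (a * b) * (x * y)   ≈⟨ *-assoc a b (x * y) ⟩
        a * (b * (x * y))   ≈⟨ *-congˡ (*-assoc b x y) ⟨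
        a * ((b * x) * y)   ≈⟨ *-congˡ (*-congʳ (*-comm b x)) ⟩
        a * ((x * b) * y)   ≈⟨ *-congˡ (*-assoc x b y) ⟩
        a * (x * (b * y))   ≈⟨ *-assoc a x (b * y) ⟨
        (a * x) * (b * y)   ∎

    isZero : ℤ → Bool
    isZero (+ zero) = true
    isZero _        = false

    ℤ-rawRing : RawRing _ _
    ℤ-rawRing = record
      { Carrier = ℤ ; _≈_ = _≡_ ; _+_ = ℤ._+_ ; _*_ = ℤ._*_ ; -_ = ℤ.-_ ; 0# = + 0 ; 1# = + 1 }

    ring′ : ACR.AlmostCommutativeRing c ℓ
    ring′ = ACR.fromCommutativeRing R (λ _ → nothing)

    homomorphism : Homomorphism _ _ _ _
    homomorphism = record
      { from          = record { rawRing = ℤ-rawRing ; isZero = isZero }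
      ; to            = ring′
      ; morphism      = record
        { ⟦_⟧    = ⟦_⟧ℤ
        ; +-homo = ⟦⟧ℤ-+
        ; *-homo = ⟦⟧ℤ-*
        ; -‿homo = ⟦⟧ℤ-neg
        ; 0-homo = refl
        ; 1-homo = refl
        }
      ; Zero-C⟶Zero-R = zero-homo
      }
      where
      zero-homo : ∀ i → T (isZero i) → 0# ≈ ⟦ i ⟧ℤ
      zero-homo (+ zero) _ = refl

  module Ops where
    open Eval rawRing ⟦_⟧ℤ public
    open import Tactic.RingSolver.Core.Polynomial.Base (Homomorphism.from homomorphism)

    norm : ∀ {n} → Expr ℤ n → Poly n
    norm (Κ x)   = κ x
    norm (Ι x)   = ι x
    norm (x ⊕ y) = norm x ⊞ norm y
    norm (x ⊗ y) = norm x ⊠ norm y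
    norm (⊝ x)   = ⊟ norm x
    norm (x ⊛ i) = norm x ⊡ i

    ⟦_⇓⟧ : ∀ {n} → Expr ℤ n → Vec Carrier n → Carrier
    ⟦ expr ⇓⟧ = ⟦ norm expr ⟧ₚ
      where open import Tactic.RingSolver.Core.Polynomial.Semantics homomorphism renaming (⟦_⟧ to ⟦_⟧ₚ)

    correct : ∀ {n} (expr : Expr ℤ n) ρ → ⟦ expr ⇓⟧ ρ ≈ ⟦ expr ⟧ ρ
    correct {n} = go
      where
      open import Tactic.RingSolver.Core.Polynomial.Homomorphism homomorphism
      open import Algebra.Properties.Semiring.Exp.TCOptimised semiring using (^-congˡ)

      go : ∀ (expr : Expr ℤ n) ρ → ⟦ expr ⇓⟧ ρ ≈ ⟦ expr ⟧ ρ
      go (Κ x)   ρ = κ-hom x ρ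
      go (Ι x)   ρ = ι-hom x ρ
      go (x ⊕ y) ρ = trans (⊞-hom (norm x) (norm y) ρ) (+-cong (go x ρ) (go y ρ))
      go (x ⊗ y) ρ = trans (⊠-hom (norm x) (norm y) ρ) (*-cong (go x ρ) (go y ρ))
      go (⊝ x)   ρ = trans (⊟-hom (norm x) ρ) (-‿cong (go x ρ))
      go (x ⊛ i) ρ = trans (⊡-hom (norm x) i ρ) (^-congˡ i (go x ρ))

    open import Relation.Binary.Reflection setoid Ι ⟦_⟧ ⟦_⇓⟧ correct public

  solve : ∀ (n : ℕ) (f : N-ary n (Expr ℤ n) (Expr ℤ n × Expr ℤ n)) →
          Eqʰ n _≈_ (curryⁿ (Ops.⟦_⇓⟧ (proj₁ (Ops.close n f)))) (curryⁿ (Ops.⟦_⇓⟧ (proj₂ (Ops.close n f)))) →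
          Eq  n _≈_ (curryⁿ (Ops.⟦_⟧  (proj₁ (Ops.close n f)))) (curryⁿ (Ops.⟦_⟧  (proj₂ (Ops.close n f))))
  solve = Ops.solve

  infixl 3 _⊜_
  _⊜_ : ∀ {n} → Expr ℤ n → Expr ℤ n → Expr ℤ n × Expr ℤ n
  _⊜_ = _,_

-- The coordinate formulas on ring-solver expressions, so that identities between them
-- can be stated by name and checked by the solver.
module Sym {n : ℕ} where
  open import Data.Integer.Base using (ℤ; +_)
  open import Tactic.RingSolver.Core.Expression using (Expr; Κ; _⊕_; _⊗_; ⊝_)

  κ : ℕ → Expr ℤ n
  κ k = Κ (+ k)

  record Triple′ : Set where
    constructor ⟨_,_,_⟩
    field c₀ c₁ c₂ : Expr ℤ n
  open Triple′ public

  join : Triple′ → Triple′ → Triple′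
  join ⟨ a₀ , a₁ , a₂ ⟩ ⟨ b₀ , b₁ , b₂ ⟩ =
    ⟨ a₁ ⊗ b₂ ⊕ ⊝ (a₂ ⊗ b₁) , a₂ ⊗ b₀ ⊕ ⊝ (a₀ ⊗ b₂) , a₀ ⊗ b₁ ⊕ ⊝ (a₁ ⊗ b₀) ⟩

  dot : Triple′ → Triple′ → Expr ℤ n
  dot ⟨ a , b , c ⟩ ⟨ d , e , f ⟩ = a ⊗ d ⊕ b ⊗ e ⊕ c ⊗ f

  conicPoint : Expr ℤ n → Expr ℤ n → Triple′
  conicPoint s t = ⟨ s ⊗ s , s ⊗ t , t ⊗ t ⟩

  tangentAt : Expr ℤ n → Expr ℤ n → Triple′
  tangentAt s t = ⟨ t ⊗ t , ⊝ (κ 2 ⊗ (s ⊗ t)) , s ⊗ s ⟩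

  det : Expr ℤ n → Expr ℤ n → Expr ℤ n → Expr ℤ n → Expr ℤ n
  det s t s′ t′ = s ⊗ t′ ⊕ ⊝ (s′ ⊗ t)

  Δ : Triple′ → Expr ℤ n
  Δ ⟨ a , b , c ⟩ = b ⊗ b ⊕ ⊝ (κ 4 ⊗ (a ⊗ c))

  conicForm : Triple′ → Expr ℤ n
  conicForm ⟨ a , b , c ⟩ = b ⊗ b ⊕ ⊝ (a ⊗ c)

  scale : Expr ℤ n → Triple′ → Triple′
  scale k ⟨ a , b , c ⟩ = ⟨ k ⊗ a , k ⊗ b , k ⊗ c ⟩

Fin-injective⇒surjective : ∀ {n} (f : Fin n → Fin n) → (∀ {i j} → f i ≡ f j → i ≡ j) → ∀ j → ∃ λ i → f i ≡ j
Fin-injective⇒surjective {ℕ.suc _} f f-inj j with Fin.any? (λ i → f i Fin.≟ j)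
... | yes hit = hit
... | no miss = ⊥-elim (ℕ.<-irrefl ≡.refl (Fin.injective⇒≤ {f = avoid} avoid-injective))
  where
  j≢f : ∀ i → j ≢ f i
  j≢f i e = miss (i , ≡.sym e)
  avoid : Fin (ℕ.suc _) → Fin _
  avoid i = punchOut (j≢f i)
  avoid-injective : ∀ {x y} → avoid x ≡ avoid y → x ≡ y
  avoid-injective e = f-inj (Fin.punchOut-injective (j≢f _) (j≢f _) e)

module Geometry {q : ℕ} (F : FiniteField q) where
  open import Data.Fin.Base using (toℕ)
  open import Data.Sum using (inj₁; inj₂)
  open import Function.Bundles using (Inverse; mk⇔)
  open import Function.Properties.Equivalence using () renaming (trans to ⇔-trans; sym to ⇔-sym)
  open import Relation.Nullary using (Dec)
  open import Relation.Binary.PropositionalEquality using (refl; sym; trans; cong; cong₂; subst)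
  open import Tactic.RingSolver.Core.Expression using (_⊕_; _⊗_; ⊝_)

  open FiniteField F
  open PG2 F
  open Inverse enumerate using () renaming
    (to to element; from to position; strictlyInverseˡ to element∘position; strictlyInverseʳ to position∘element)

  commutativeRing : CommutativeRing _ _
  commutativeRing = record { isCommutativeRing = isCommutativeRing }

  open CommutativeRing commutativeRing using (*-comm; *-assoc; +-identityʳ; *-identityˡ; -‿inverseʳ; zeroˡ; zeroʳ)
  open IntegerCoefficientSolver commutativeRing using (solve; _⊜_)
  open Sym using (κ)

  -- Bracketed as the solver constants κ 2 and κ 4 unfold.
  two four : Carrier
  two  = 1# + 1#
  four = 1# + 1# + 1# + 1#

  dot : Triple → Triple → Carrier
  dot u v = c₀ u * c₀ v + c₁ u * c₁ v + c₂ u * c₂ v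

  IsZero : Triple → Set
  IsZero u = c₀ u ≡ 0# × c₁ u ≡ 0# × c₂ u ≡ 0#

  NonZero₂ : Carrier → Carrier → Set
  NonZero₂ s t = ¬ (s ≡ 0# × t ≡ 0#)

  -- (s : t) ↦ (s², st, t²) parametrises 𝒪 by PG(1,q); its polar is the tangent there.
  conicPoint : Carrier → Carrier → Triple
  conicPoint s t = ⟨ s * s , s * t , t * t ⟩

  tangentAt : Carrier → Carrier → Triple
  tangentAt s t = conicPoint s t ⊥

  det : Carrier → Carrier → Carrier → Carrier → Carrier
  det s t s′ t′ = s * t′ + - (s′ * t)

  -- The conic points on a line [m₀, m₁, m₂] are the roots (x : y) of m₀x² + m₁xy + m₂y².
  Δ : Triple → Carrier
  Δ l = c₁ l * c₁ l + - (four * (c₀ l * c₂ l))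

  conicForm : Triple → Carrier
  conicForm u = c₁ u * c₁ u + - (c₀ u * c₂ u)

  1≢0 : 1# ≢ 0#
  1≢0 e = 0≢1 (sym e)

  -- An equation that holds modulo quantities known to vanish is proved by writing the
  -- difference as an explicit combination of them (a ring identity for the solver).
  ≡-up-to-zero : ∀ {L R H} → L ≡ R + H → H ≡ 0# → L ≡ R
  ≡-up-to-zero {R = R} e h = trans e (trans (cong (R +_) h) (+-identityʳ R))

  *-≡0 : ∀ c {d} → d ≡ 0# → c * d ≡ 0#
  *-≡0 c h = trans (cong (c *_) h) (zeroʳ c)

  +-≡0 : ∀ {a b} → a ≡ 0# → b ≡ 0# → a + b ≡ 0#
  +-≡0 h k = trans (cong₂ _+_ h k) (+-identityʳ 0#)

  x≡y⇒x-y≡0 : ∀ {x y} → x ≡ y → x + - y ≡ 0#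
  x≡y⇒x-y≡0 {y = y} e = trans (cong (_+ - y) e) (-‿inverseʳ y)

  x-y≡0⇒x≡y : ∀ {x y} → x + - y ≡ 0# → x ≡ y
  x-y≡0⇒x≡y {x} {y} = ≡-up-to-zero (solve 2 (λ x y → x ⊜ y ⊕ (x ⊕ ⊝ y)) refl x y)

  inv : ∀ {x} → x ≢ 0# → Carrier
  inv {x} p = proj₁ (inverse x p)

  x*inv-1≡0 : ∀ {x} (p : x ≢ 0#) → x * inv p + - 1# ≡ 0#
  x*inv-1≡0 {x} p = x≡y⇒x-y≡0 (proj₂ (inverse x p))

  *-integral : ∀ a b → a * b ≡ 0# → a ≡ 0# ⊎ b ≡ 0#
  *-integral a b ab≡0 with a ≟ 0#
  ... | yes a≡0 = inj₁ a≡0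
  ... | no  a≢0 = inj₂ (≡-up-to-zero
    (solve 3 (λ a b i → b ⊜ κ 0 ⊕ (⊝ b ⊗ (a ⊗ i ⊕ ⊝ κ 1) ⊕ i ⊗ (a ⊗ b))) refl a b (inv a≢0))
    (+-≡0 (*-≡0 (- b) (x*inv-1≡0 a≢0)) (*-≡0 (inv a≢0) ab≡0)))

  *-nonzero : ∀ {a b} → a ≢ 0# → b ≢ 0# → a * b ≢ 0#
  *-nonzero {a} {b} a≢0 b≢0 ab≡0 with *-integral a b ab≡0
  ... | inj₁ a≡0 = a≢0 a≡0
  ... | inj₂ b≡0 = b≢0 b≡0

  x*x≡0⇒x≡0 : ∀ {x} → x * x ≡ 0# → x ≡ 0#
  x*x≡0⇒x≡0 {x} e with *-integral x x e
  ... | inj₁ x≡0 = x≡0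
  ... | inj₂ x≡0 = x≡0

  inv≢0 : ∀ {x} (p : x ≢ 0#) → inv p ≢ 0#
  inv≢0 {x} p i≡0 = 1≢0 (trans (sym (proj₂ (inverse x p))) (*-≡0 x i≡0))

  proportional : ∀ {x x′ c c′} (p : x ≢ 0#) → x * c′ ≡ x′ * c → c′ ≡ (c * inv p) * x′
  proportional {x} {x′} {c} {c′} p e = ≡-up-to-zero
    (solve 5 (λ x x′ c c′ i → c′ ⊜ (c ⊗ i) ⊗ x′ ⊕ (⊝ c′ ⊗ (x ⊗ i ⊕ ⊝ κ 1) ⊕ i ⊗ (x ⊗ c′ ⊕ ⊝ (x′ ⊗ c))))
       refl x x′ c c′ (inv p))
    (+-≡0 (*-≡0 (- c′) (x*inv-1≡0 p)) (*-≡0 (inv p) (x≡y⇒x-y≡0 e)))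

  ∼-sym : ∀ {u v} → u ∼ v → v ∼ u
  ∼-sym (k , k≢0 , e₀ , e₁ , e₂) = inv k≢0 , inv≢0 k≢0 , back e₀ , back e₁ , back e₂
    where
    back : ∀ {a b} → b ≡ k * a → a ≡ inv k≢0 * b
    back {a} {b} e = trans (proportional k≢0 (trans (sym e) (sym (*-identityˡ b))))
                           (solve 2 (λ b i → (b ⊗ i) ⊗ κ 1 ⊜ i ⊗ b) refl b (inv k≢0))

  ∼-trans : ∀ {u v w} → u ∼ v → v ∼ w → u ∼ w
  ∼-trans (k , k≢0 , e₀ , e₁ , e₂) (k′ , k′≢0 , f₀ , f₁ , f₂) =
    k′ * k , *-nonzero k′≢0 k≢0 , compose f₀ e₀ , compose f₁ e₁ , compose f₂ e₂
    where
    compose : ∀ {a b c} → c ≡ k′ * b → b ≡ k * a → c ≡ (k′ * k) * a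
    compose f e = trans f (trans (cong (k′ *_) e) (sym (*-assoc _ _ _)))

  ∼-by-scalar : ∀ {u v k} → NonZero v →
                c₀ v ≡ k * c₀ u → c₁ v ≡ k * c₁ u → c₂ v ≡ k * c₂ u → u ∼ v
  ∼-by-scalar {k = k} v≢0 e₀ e₁ e₂ = k , k≢0 , e₀ , e₁ , e₂
    where
    vanish : ∀ {a b} → k ≡ 0# → b ≡ k * a → b ≡ 0#
    vanish k≡0 e = trans e (trans (cong (_* _) k≡0) (zeroˡ _))
    k≢0 : k ≢ 0#
    k≢0 k≡0 = v≢0 (vanish k≡0 e₀ , vanish k≡0 e₁ , vanish k≡0 e₂)

  dot-comm : ∀ u v → dot u v ≡ dot v u
  dot-comm ⟨ a , b , c ⟩ ⟨ x , y , z ⟩ =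
    solve 6 (λ a b c x y z → Sym.dot Sym.⟨ a , b , c ⟩ Sym.⟨ x , y , z ⟩ ⊜ Sym.dot Sym.⟨ x , y , z ⟩ Sym.⟨ a , b , c ⟩)
      refl a b c x y z

  ∼-I : ∀ {u v l} → u ∼ v → u I l → v I l
  ∼-I {⟨ a , b , c ⟩} {l = ⟨ x , y , z ⟩} (k , _ , refl , refl , refl) uIl = trans
    (solve 7 (λ a b c x y z k → Sym.dot (Sym.scale k Sym.⟨ a , b , c ⟩) Sym.⟨ x , y , z ⟩
                                ⊜ k ⊗ Sym.dot Sym.⟨ a , b , c ⟩ Sym.⟨ x , y , z ⟩) refl a b c x y z k)
    (*-≡0 k uIl)

  I-sym : ∀ {u l} → u I l → l I u
  I-sym {u} {l} h = trans (dot-comm l u) h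

  I-∼ : ∀ {u l l′} → l ∼ l′ → u I l → u I l′
  I-∼ r h = I-sym (∼-I r (I-sym h))

  zero₂? : ∀ x y → (x ≡ 0# × y ≡ 0#) ⊎ NonZero₂ x y
  zero₂? x y with x ≟ 0# | y ≟ 0#
  ... | yes x≡0 | yes y≡0 = inj₁ (x≡0 , y≡0)
  ... | no  x≢0 | _       = inj₂ (λ z → x≢0 (proj₁ z))
  ... | yes _   | no  y≢0 = inj₂ (λ z → y≢0 (proj₂ z))

  join≡0⇒∼ : ∀ {X C} → NonZero X → NonZero C → IsZero (join X C) → X ∼ C
  join≡0⇒∼ {⟨ x₀ , x₁ , x₂ ⟩} {⟨ c₀ , c₁ , c₂ ⟩} X≢0 C≢0 (z₀ , z₁ , z₂)
    with x₀ ≟ 0# | x₁ ≟ 0# | x₂ ≟ 0#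
  ... | no p | _ | _ =
    ∼-by-scalar C≢0 (proportional p refl) (proportional p (x-y≡0⇒x≡y z₂)) (proportional p (sym (x-y≡0⇒x≡y z₁)))
  ... | yes _ | no p | _ =
    ∼-by-scalar C≢0 (proportional p (sym (x-y≡0⇒x≡y z₂))) (proportional p refl) (proportional p (x-y≡0⇒x≡y z₀))
  ... | yes _ | yes _ | no p =
    ∼-by-scalar C≢0 (proportional p (x-y≡0⇒x≡y z₁)) (proportional p (sym (x-y≡0⇒x≡y z₀))) (proportional p refl)
  ... | yes z₀′ | yes z₁′ | yes z₂′ = ⊥-elim (X≢0 (z₀′ , z₁′ , z₂′))

  -- X × (A × B) = (X·B) A − (X·A) B.
  I-both⇒∼join : ∀ {X A B} → NonZero X → X I A → X I B → NonZero (join A B) → X ∼ join A B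
  I-both⇒∼join {⟨ x₀ , x₁ , x₂ ⟩} {⟨ a₀ , a₁ , a₂ ⟩} {⟨ b₀ , b₁ , b₂ ⟩} X≢0 XA XB AB≢0 =
    join≡0⇒∼ X≢0 AB≢0
      ( ≡-up-to-zero (solve 9 (λ x₀ x₁ x₂ a₀ a₁ a₂ b₀ b₁ b₂ →
            let X = Sym.⟨ x₀ , x₁ , x₂ ⟩ ; A = Sym.⟨ a₀ , a₁ , a₂ ⟩ ; B = Sym.⟨ b₀ , b₁ , b₂ ⟩ in
            Sym.c₀ (Sym.join X (Sym.join A B)) ⊜ κ 0 ⊕ (a₀ ⊗ Sym.dot X B ⊕ ⊝ b₀ ⊗ Sym.dot X A))
          refl x₀ x₁ x₂ a₀ a₁ a₂ b₀ b₁ b₂) (+-≡0 (*-≡0 a₀ XB) (*-≡0 (- b₀) XA))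
      , ≡-up-to-zero (solve 9 (λ x₀ x₁ x₂ a₀ a₁ a₂ b₀ b₁ b₂ →
            let X = Sym.⟨ x₀ , x₁ , x₂ ⟩ ; A = Sym.⟨ a₀ , a₁ , a₂ ⟩ ; B = Sym.⟨ b₀ , b₁ , b₂ ⟩ in
            Sym.c₁ (Sym.join X (Sym.join A B)) ⊜ κ 0 ⊕ (a₁ ⊗ Sym.dot X B ⊕ ⊝ b₁ ⊗ Sym.dot X A))
          refl x₀ x₁ x₂ a₀ a₁ a₂ b₀ b₁ b₂) (+-≡0 (*-≡0 a₁ XB) (*-≡0 (- b₁) XA))
      , ≡-up-to-zero (solve 9 (λ x₀ x₁ x₂ a₀ a₁ a₂ b₀ b₁ b₂ →
            let X = Sym.⟨ x₀ , x₁ , x₂ ⟩ ; A = Sym.⟨ a₀ , a₁ , a₂ ⟩ ; B = Sym.⟨ b₀ , b₁ , b₂ ⟩ in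
            Sym.c₂ (Sym.join X (Sym.join A B)) ⊜ κ 0 ⊕ (a₂ ⊗ Sym.dot X B ⊕ ⊝ b₂ ⊗ Sym.dot X A))
          refl x₀ x₁ x₂ a₀ a₁ a₂ b₀ b₁ b₂) (+-≡0 (*-≡0 a₂ XB) (*-≡0 (- b₂) XA)) )

  ∼⇒join≡0 : ∀ {u v} → u ∼ v → IsZero (join u v)
  ∼⇒join≡0 {⟨ a , b , c ⟩} (k , _ , refl , refl , refl) =
      solve 4 (λ a b c k → Sym.c₀ (Sym.join Sym.⟨ a , b , c ⟩ (Sym.scale k Sym.⟨ a , b , c ⟩)) ⊜ κ 0) refl a b c k
    , solve 4 (λ a b c k → Sym.c₁ (Sym.join Sym.⟨ a , b , c ⟩ (Sym.scale k Sym.⟨ a , b , c ⟩)) ⊜ κ 0) refl a b c k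
    , solve 4 (λ a b c k → Sym.c₂ (Sym.join Sym.⟨ a , b , c ⟩ (Sym.scale k Sym.⟨ a , b , c ⟩)) ⊜ κ 0) refl a b c k

  I-joinˡ : ∀ X Y → X I join X Y
  I-joinˡ ⟨ a , b , c ⟩ ⟨ x , y , z ⟩ =
    solve 6 (λ a b c x y z → Sym.dot Sym.⟨ a , b , c ⟩ (Sym.join Sym.⟨ a , b , c ⟩ Sym.⟨ x , y , z ⟩) ⊜ κ 0)
      refl a b c x y z

  I-joinʳ : ∀ X Y → Y I join X Y
  I-joinʳ ⟨ a , b , c ⟩ ⟨ x , y , z ⟩ =
    solve 6 (λ a b c x y z → Sym.dot Sym.⟨ x , y , z ⟩ (Sym.join Sym.⟨ a , b , c ⟩ Sym.⟨ x , y , z ⟩) ⊜ κ 0)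
      refl a b c x y z

  join-congʳ : ∀ P {X Y} → X ∼ Y → join P X ∼ join P Y
  join-congʳ ⟨ p₀ , p₁ , p₂ ⟩ {⟨ a , b , c ⟩} (k , k≢0 , refl , refl , refl) = k , k≢0 ,
      solve 7 (λ p₀ p₁ p₂ a b c k → let P = Sym.⟨ p₀ , p₁ , p₂ ⟩ ; X = Sym.⟨ a , b , c ⟩ in
        Sym.c₀ (Sym.join P (Sym.scale k X)) ⊜ k ⊗ Sym.c₀ (Sym.join P X)) refl p₀ p₁ p₂ a b c k
    , solve 7 (λ p₀ p₁ p₂ a b c k → let P = Sym.⟨ p₀ , p₁ , p₂ ⟩ ; X = Sym.⟨ a , b , c ⟩ in
        Sym.c₁ (Sym.join P (Sym.scale k X)) ⊜ k ⊗ Sym.c₁ (Sym.join P X)) refl p₀ p₁ p₂ a b c k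
    , solve 7 (λ p₀ p₁ p₂ a b c k → let P = Sym.⟨ p₀ , p₁ , p₂ ⟩ ; X = Sym.⟨ a , b , c ⟩ in
        Sym.c₂ (Sym.join P (Sym.scale k X)) ⊜ k ⊗ Sym.c₂ (Sym.join P X)) refl p₀ p₁ p₂ a b c k

  IsZero⇒conicForm≡0 : ∀ {u} → IsZero u → conicForm u ≡ 0#
  IsZero⇒conicForm≡0 {⟨ a , b , c ⟩} (a≡0 , b≡0 , _) = ≡-up-to-zero
    (solve 3 (λ a b c → Sym.conicForm Sym.⟨ a , b , c ⟩ ⊜ κ 0 ⊕ (b ⊗ b ⊕ ⊝ c ⊗ a)) refl a b c)
    (+-≡0 (*-≡0 b b≡0) (*-≡0 (- c) a≡0))

  IsZero⇒Δ≡0 : ∀ {u} → IsZero u → Δ u ≡ 0#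
  IsZero⇒Δ≡0 {⟨ a , b , c ⟩} (a≡0 , b≡0 , _) = ≡-up-to-zero
    (solve 3 (λ a b c → Sym.Δ Sym.⟨ a , b , c ⟩ ⊜ κ 0 ⊕ (b ⊗ b ⊕ ⊝ (κ 4 ⊗ c) ⊗ a)) refl a b c)
    (+-≡0 (*-≡0 b b≡0) (*-≡0 (- (four * c)) a≡0))

  det⁴≡0⇒det≡0 : ∀ {d} → (d * d) * (d * d) ≡ 0# → d ≡ 0#
  det⁴≡0⇒det≡0 e = x*x≡0⇒x≡0 (x*x≡0⇒x≡0 e)

  conicPoint-NonZero : ∀ {s t} → NonZero₂ s t → NonZero (conicPoint s t)
  conicPoint-NonZero st≢0 (z₀ , _ , z₂) = st≢0 (x*x≡0⇒x≡0 z₀ , x*x≡0⇒x≡0 z₂)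

  tangentAt-NonZero : ∀ {s t} → NonZero₂ s t → NonZero (tangentAt s t)
  tangentAt-NonZero st≢0 (z₀ , _ , z₂) = st≢0 (x*x≡0⇒x≡0 z₂ , x*x≡0⇒x≡0 z₀)

  OnConic⇒conicPoint : ∀ {w} → OnConic w → Σ Carrier λ s → Σ Carrier λ t → NonZero₂ s t × w ∼ conicPoint s t
  OnConic⇒conicPoint (inj₁ (t , w∼)) =
    1# , t , (λ z → 1≢0 (proj₁ z)) , ∼-trans w∼ (1# , 1≢0 , refl , refl , sym (*-identityˡ _))
  OnConic⇒conicPoint (inj₂ w∼) =
    0# , 1# , (λ z → 1≢0 (proj₂ z)) , ∼-trans w∼ (1# , 1≢0 ,
      solve 0 (κ 0 ⊗ κ 0 ⊜ κ 1 ⊗ κ 0) refl , solve 0 (κ 0 ⊗ κ 1 ⊜ κ 1 ⊗ κ 0) refl , solve 0 (κ 1 ⊗ κ 1 ⊜ κ 1 ⊗ κ 1) refl)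

  conicPoint-OnConic : ∀ {s t} → NonZero₂ s t → OnConic (conicPoint s t)
  conicPoint-OnConic {s} {t} st≢0 with s ≟ 0#
  ... | no s≢0 = inj₁ (t * i , i * i , *-nonzero (inv≢0 s≢0) (inv≢0 s≢0) ,
        ≡-up-to-zero (solve 2 (λ s i → κ 1 ⊜ (i ⊗ i) ⊗ (s ⊗ s) ⊕ ⊝ (s ⊗ i ⊕ κ 1) ⊗ (s ⊗ i ⊕ ⊝ κ 1)) refl s i)
          (*-≡0 _ (x*inv-1≡0 s≢0)) ,
        ≡-up-to-zero (solve 3 (λ s t i → t ⊗ i ⊜ (i ⊗ i) ⊗ (s ⊗ t) ⊕ ⊝ (t ⊗ i) ⊗ (s ⊗ i ⊕ ⊝ κ 1)) refl s t i)
          (*-≡0 _ (x*inv-1≡0 s≢0)) ,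
        solve 2 (λ t i → (t ⊗ i) ⊗ (t ⊗ i) ⊜ (i ⊗ i) ⊗ (t ⊗ t)) refl t i)
    where i = inv s≢0
  ... | yes s≡0 with t ≟ 0#
  ...   | yes t≡0 = ⊥-elim (st≢0 (s≡0 , t≡0))
  ...   | no t≢0 = inj₂ (i * i , *-nonzero (inv≢0 t≢0) (inv≢0 t≢0) ,
        ≡-up-to-zero (solve 2 (λ s i → κ 0 ⊜ (i ⊗ i) ⊗ (s ⊗ s) ⊕ ⊝ (i ⊗ i ⊗ s) ⊗ s) refl s i) (*-≡0 _ s≡0) ,
        ≡-up-to-zero (solve 3 (λ s t i → κ 0 ⊜ (i ⊗ i) ⊗ (s ⊗ t) ⊕ ⊝ (i ⊗ i ⊗ t) ⊗ s) refl s t i) (*-≡0 _ s≡0) ,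
        ≡-up-to-zero (solve 2 (λ t i → κ 1 ⊜ (i ⊗ i) ⊗ (t ⊗ t) ⊕ ⊝ (t ⊗ i ⊕ κ 1) ⊗ (t ⊗ i ⊕ ⊝ κ 1)) refl t i)
          (*-≡0 _ (x*inv-1≡0 t≢0)))
    where i = inv t≢0

  -- Both joins are det s t s′ t′ times a vector whose Δ, resp. conicForm, is det².
  Δ-join-conicPoint : ∀ s t s′ t′ →
    Δ (join (conicPoint s t) (conicPoint s′ t′)) ≡ (det s t s′ t′ * det s t s′ t′) * (det s t s′ t′ * det s t s′ t′)
  Δ-join-conicPoint s t s′ t′ = solve 4 (λ s t s′ t′ →
    Sym.Δ (Sym.join (Sym.conicPoint s t) (Sym.conicPoint s′ t′))
      ⊜ (Sym.det s t s′ t′ ⊗ Sym.det s t s′ t′) ⊗ (Sym.det s t s′ t′ ⊗ Sym.det s t s′ t′)) refl s t s′ t′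

  conicForm-join-tangentAt : ∀ s t s′ t′ →
    conicForm (join (tangentAt s t) (tangentAt s′ t′)) ≡ (det s t s′ t′ * det s t s′ t′) * (det s t s′ t′ * det s t s′ t′)
  conicForm-join-tangentAt s t s′ t′ = solve 4 (λ s t s′ t′ →
    Sym.conicForm (Sym.join (Sym.tangentAt s t) (Sym.tangentAt s′ t′))
      ⊜ (Sym.det s t s′ t′ ⊗ Sym.det s t s′ t′) ⊗ (Sym.det s t s′ t′ ⊗ Sym.det s t s′ t′)) refl s t s′ t′

  conicPoint∼⇒det≡0 : ∀ {s t s′ t′} → conicPoint s t ∼ conicPoint s′ t′ → det s t s′ t′ ≡ 0#
  conicPoint∼⇒det≡0 {s} {t} {s′} {t′} r =
    det⁴≡0⇒det≡0 (trans (sym (Δ-join-conicPoint s t s′ t′)) (IsZero⇒Δ≡0 (∼⇒join≡0 r)))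

  tangentAt∼⇒det≡0 : ∀ {s t s′ t′} → tangentAt s t ∼ tangentAt s′ t′ → det s t s′ t′ ≡ 0#
  tangentAt∼⇒det≡0 {s} {t} {s′} {t′} r =
    det⁴≡0⇒det≡0 (trans (sym (conicForm-join-tangentAt s t s′ t′)) (IsZero⇒conicForm≡0 (∼⇒join≡0 r)))

  join-tangentAt-NonZero : ∀ {s t s′ t′} → det s t s′ t′ ≢ 0# → NonZero (join (tangentAt s t) (tangentAt s′ t′))
  join-tangentAt-NonZero {s} {t} {s′} {t′} d≢0 z =
    d≢0 (det⁴≡0⇒det≡0 (trans (sym (conicForm-join-tangentAt s t s′ t′)) (IsZero⇒conicForm≡0 z)))

  det≡0⇒conicPoint∼ : ∀ {s t s′ t′} → det s t s′ t′ ≡ 0# → NonZero₂ s t → NonZero₂ s′ t′ →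
                      conicPoint s t ∼ conicPoint s′ t′
  det≡0⇒conicPoint∼ {s} {t} {s′} {t′} d≡0 st≢0 st′≢0 =
    join≡0⇒∼ (conicPoint-NonZero st≢0) (conicPoint-NonZero st′≢0)
      ( ≡-up-to-zero (solve 4 (λ s t s′ t′ → Sym.c₀ (Sym.join (Sym.conicPoint s t) (Sym.conicPoint s′ t′))
                                  ⊜ κ 0 ⊕ (t ⊗ t′) ⊗ Sym.det s t s′ t′) refl s t s′ t′) (*-≡0 _ d≡0)
      , ≡-up-to-zero (solve 4 (λ s t s′ t′ → Sym.c₁ (Sym.join (Sym.conicPoint s t) (Sym.conicPoint s′ t′))
                                  ⊜ κ 0 ⊕ ⊝ (s ⊗ t′ ⊕ s′ ⊗ t) ⊗ Sym.det s t s′ t′) refl s t s′ t′) (*-≡0 _ d≡0)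
      , ≡-up-to-zero (solve 4 (λ s t s′ t′ → Sym.c₂ (Sym.join (Sym.conicPoint s t) (Sym.conicPoint s′ t′))
                                  ⊜ κ 0 ⊕ (s ⊗ s′) ⊗ Sym.det s t s′ t′) refl s t s′ t′) (*-≡0 _ d≡0) )

  det≡0⇒tangentAt∼ : ∀ {s t s′ t′} → det s t s′ t′ ≡ 0# → NonZero₂ s t → NonZero₂ s′ t′ →
                     tangentAt s t ∼ tangentAt s′ t′
  det≡0⇒tangentAt∼ {s} {t} {s′} {t′} d≡0 st≢0 st′≢0 =
    join≡0⇒∼ (tangentAt-NonZero st≢0) (tangentAt-NonZero st′≢0)
      ( ≡-up-to-zero (solve 4 (λ s t s′ t′ → Sym.c₀ (Sym.join (Sym.tangentAt s t) (Sym.tangentAt s′ t′))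
                                  ⊜ κ 0 ⊕ (κ 2 ⊗ (s ⊗ s′)) ⊗ Sym.det s t s′ t′) refl s t s′ t′) (*-≡0 _ d≡0)
      , ≡-up-to-zero (solve 4 (λ s t s′ t′ → Sym.c₁ (Sym.join (Sym.tangentAt s t) (Sym.tangentAt s′ t′))
                                  ⊜ κ 0 ⊕ (s ⊗ t′ ⊕ s′ ⊗ t) ⊗ Sym.det s t s′ t′) refl s t s′ t′) (*-≡0 _ d≡0)
      , ≡-up-to-zero (solve 4 (λ s t s′ t′ → Sym.c₂ (Sym.join (Sym.tangentAt s t) (Sym.tangentAt s′ t′))
                                  ⊜ κ 0 ⊕ (κ 2 ⊗ (t ⊗ t′)) ⊗ Sym.det s t s′ t′) refl s t s′ t′) (*-≡0 _ d≡0) )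

  ≁⇒det≢0 : ∀ {ℓ ℓ′ s t s′ t′} → NonZero₂ s t → NonZero₂ s′ t′ →
            ℓ ∼ tangentAt s t → ℓ′ ∼ tangentAt s′ t′ → ¬ ℓ ∼ ℓ′ → det s t s′ t′ ≢ 0#
  ≁⇒det≢0 st≢0 st′≢0 ℓ∼ ℓ′∼ ℓ≁ℓ′ d≡0 =
    ℓ≁ℓ′ (∼-trans ℓ∼ (∼-trans (det≡0⇒tangentAt∼ d≡0 st≢0 st′≢0) (∼-sym ℓ′∼)))

  conicPoint-dot-tangentAt : ∀ s t x y → dot (conicPoint x y) (tangentAt s t) ≡ det s t x y * det s t x y
  conicPoint-dot-tangentAt s t x y = solve 4 (λ s t x y →
    Sym.dot (Sym.conicPoint x y) (Sym.tangentAt s t) ⊜ Sym.det s t x y ⊗ Sym.det s t x y) refl s t x y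

  det-self≡0 : ∀ s t → det s t s t ≡ 0#
  det-self≡0 s t = solve 2 (λ s t → Sym.det s t s t ⊜ κ 0) refl s t

  tangentAt-Tangent : ∀ {s t} → NonZero₂ s t → Tangent (tangentAt s t)
  tangentAt-Tangent {s} {t} st≢0 =
    conicPoint s t , conicPoint-NonZero st≢0 ,
    (conicPoint-OnConic st≢0 , trans (conicPoint-dot-tangentAt s t s t) (*-≡0 _ (det-self≡0 s t))) , unique
    where
    unique : ∀ w → NonZero w → OnConic w × w I tangentAt s t → w ∼ conicPoint s t
    unique w _ (w∈𝒪 , wI) with OnConic⇒conicPoint w∈𝒪
    ... | x , y , xy≢0 , w∼ = ∼-trans w∼ (∼-sym (det≡0⇒conicPoint∼
          (x*x≡0⇒x≡0 (trans (sym (conicPoint-dot-tangentAt s t x y)) (∼-I w∼ wI))) st≢0 xy≢0))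

  cancel-square : ∀ {t J} → t ≢ 0# → (t * t) * J ≡ 0# → J ≡ 0#
  cancel-square {t} {J} t≢0 e with *-integral (t * t) J e
  ... | inj₁ tt≡0 = ⊥-elim (t≢0 (x*x≡0⇒x≡0 tt≡0))
  ... | inj₂ J≡0 = J≡0

  -- The other root (x : y), by Vieta, of the binary quadratic form of a line l through
  -- conicPoint s t; it coincides with (s : t) only if l is the tangent there.
  record SecondIntersection (s t : Carrier) (l : Triple) : Set where
    field
      x y           : Carrier
      I-l           : conicPoint x y I l
      det≡0⇒tangent : det s t x y ≡ 0# → IsZero (join l (tangentAt s t))

  second-intersectionᵗ : ∀ {s t} l → t ≢ 0# → conicPoint s t I l → SecondIntersection s t l
  second-intersectionᵗ {s} {t} ⟨ m₀ , m₁ , m₂ ⟩ t≢0 E = record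
    { x = m₁ * t + m₀ * s ; y = - (m₀ * t)
    ; I-l = ≡-up-to-zero (solve 5 (λ s t m₀ m₁ m₂ → let l = Sym.⟨ m₀ , m₁ , m₂ ⟩ in
        Sym.dot (Sym.conicPoint (m₁ ⊗ t ⊕ m₀ ⊗ s) (⊝ (m₀ ⊗ t))) l ⊜ κ 0 ⊕ (m₀ ⊗ m₀) ⊗ Sym.dot (Sym.conicPoint s t) l)
        refl s t m₀ m₁ m₂) (*-≡0 _ E)
    ; det≡0⇒tangent = λ D →
        cancel-square t≢0 (≡-up-to-zero (solve 5 (λ s t m₀ m₁ m₂ → let l = Sym.⟨ m₀ , m₁ , m₂ ⟩ in
          (t ⊗ t) ⊗ Sym.c₀ (Sym.join l (Sym.tangentAt s t)) ⊜ κ 0 ⊕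
            ((κ 2 ⊗ (s ⊗ t)) ⊗ Sym.dot (Sym.conicPoint s t) l ⊕ (s ⊗ s) ⊗ Sym.det s t (m₁ ⊗ t ⊕ m₀ ⊗ s) (⊝ (m₀ ⊗ t))))
          refl s t m₀ m₁ m₂) (+-≡0 (*-≡0 _ E) (*-≡0 _ D))) ,
        cancel-square t≢0 (≡-up-to-zero (solve 5 (λ s t m₀ m₁ m₂ → let l = Sym.⟨ m₀ , m₁ , m₂ ⟩ in
          (t ⊗ t) ⊗ Sym.c₁ (Sym.join l (Sym.tangentAt s t)) ⊜ κ 0 ⊕
            ((t ⊗ t) ⊗ Sym.dot (Sym.conicPoint s t) l ⊕ (s ⊗ t) ⊗ Sym.det s t (m₁ ⊗ t ⊕ m₀ ⊗ s) (⊝ (m₀ ⊗ t))))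
          refl s t m₀ m₁ m₂) (+-≡0 (*-≡0 _ E) (*-≡0 _ D))) ,
        ≡-up-to-zero (solve 5 (λ s t m₀ m₁ m₂ → let l = Sym.⟨ m₀ , m₁ , m₂ ⟩ in
          Sym.c₂ (Sym.join l (Sym.tangentAt s t)) ⊜ κ 0 ⊕ Sym.det s t (m₁ ⊗ t ⊕ m₀ ⊗ s) (⊝ (m₀ ⊗ t)))
          refl s t m₀ m₁ m₂) D
    }

  second-intersectionˢ : ∀ {s t} l → s ≢ 0# → conicPoint s t I l → SecondIntersection s t l
  second-intersectionˢ {s} {t} ⟨ m₀ , m₁ , m₂ ⟩ s≢0 E = record
    { x = - (m₂ * s) ; y = m₁ * s + m₂ * t
    ; I-l = ≡-up-to-zero (solve 5 (λ s t m₀ m₁ m₂ → let l = Sym.⟨ m₀ , m₁ , m₂ ⟩ in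
        Sym.dot (Sym.conicPoint (⊝ (m₂ ⊗ s)) (m₁ ⊗ s ⊕ m₂ ⊗ t)) l ⊜ κ 0 ⊕ (m₂ ⊗ m₂) ⊗ Sym.dot (Sym.conicPoint s t) l)
        refl s t m₀ m₁ m₂) (*-≡0 _ E)
    ; det≡0⇒tangent = λ D →
        ≡-up-to-zero (solve 5 (λ s t m₀ m₁ m₂ → let l = Sym.⟨ m₀ , m₁ , m₂ ⟩ in
          Sym.c₀ (Sym.join l (Sym.tangentAt s t)) ⊜ κ 0 ⊕ Sym.det s t (⊝ (m₂ ⊗ s)) (m₁ ⊗ s ⊕ m₂ ⊗ t))
          refl s t m₀ m₁ m₂) D ,
        cancel-square s≢0 (≡-up-to-zero (solve 5 (λ s t m₀ m₁ m₂ → let l = Sym.⟨ m₀ , m₁ , m₂ ⟩ in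
          (s ⊗ s) ⊗ Sym.c₁ (Sym.join l (Sym.tangentAt s t)) ⊜ κ 0 ⊕
            (⊝ (s ⊗ s) ⊗ Sym.dot (Sym.conicPoint s t) l ⊕ (s ⊗ t) ⊗ Sym.det s t (⊝ (m₂ ⊗ s)) (m₁ ⊗ s ⊕ m₂ ⊗ t)))
          refl s t m₀ m₁ m₂) (+-≡0 (*-≡0 _ E) (*-≡0 _ D))) ,
        cancel-square s≢0 (≡-up-to-zero (solve 5 (λ s t m₀ m₁ m₂ → let l = Sym.⟨ m₀ , m₁ , m₂ ⟩ in
          (s ⊗ s) ⊗ Sym.c₂ (Sym.join l (Sym.tangentAt s t)) ⊜ κ 0 ⊕
            (⊝ (κ 2 ⊗ (s ⊗ t)) ⊗ Sym.dot (Sym.conicPoint s t) l ⊕ (t ⊗ t) ⊗ Sym.det s t (⊝ (m₂ ⊗ s)) (m₁ ⊗ s ⊕ m₂ ⊗ t)))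
          refl s t m₀ m₁ m₂) (+-≡0 (*-≡0 _ E) (*-≡0 _ D)))
    }

  second-intersection : ∀ {s t} l → NonZero₂ s t → conicPoint s t I l → SecondIntersection s t l
  second-intersection {s} {t} l st≢0 with t ≟ 0# | s ≟ 0#
  ... | no t≢0  | _       = second-intersectionᵗ l t≢0
  ... | yes _   | no s≢0  = second-intersectionˢ l s≢0
  ... | yes t≡0 | yes s≡0 = ⊥-elim (st≢0 (s≡0 , t≡0))

  det-zeroʳ : ∀ s t {x y} → x ≡ 0# → y ≡ 0# → det s t x y ≡ 0#
  det-zeroʳ s t {x} {y} x≡0 y≡0 = ≡-up-to-zero
    (solve 4 (λ s t x y → Sym.det s t x y ⊜ κ 0 ⊕ (s ⊗ y ⊕ ⊝ t ⊗ x)) refl s t x y)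
    (+-≡0 (*-≡0 s y≡0) (*-≡0 (- t) x≡0))

  -- The second intersection of a tangent line with 𝒪 is its point of contact.
  Tangent⇒tangentAt : ∀ {l} → NonZero l → Tangent l →
                      Σ Carrier λ s → Σ Carrier λ t → NonZero₂ s t × l ∼ tangentAt s t
  Tangent⇒tangentAt {l} l≢0 (u , _ , (u∈𝒪 , uIl) , unique) with OnConic⇒conicPoint u∈𝒪
  ... | s , t , st≢0 , u∼ = s , t , st≢0 ,
        join≡0⇒∼ l≢0 (tangentAt-NonZero st≢0) (det≡0⇒tangent contact)
    where
    open SecondIntersection (second-intersection l st≢0 (∼-I u∼ uIl))
    contact : det s t x y ≡ 0#
    contact with zero₂? x y
    ... | inj₁ (x≡0 , y≡0) = det-zeroʳ s t x≡0 y≡0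
    ... | inj₂ xy≢0 = conicPoint∼⇒det≡0 (∼-sym (∼-trans
          (unique (conicPoint x y) (conicPoint-NonZero xy≢0) (conicPoint-OnConic xy≢0 , I-l)) u∼))

  -- In characteristic 2 every tangent is [t², 0, s²], so two independent ones through Q
  -- force q₀ = q₂ = 0, and then every tangent passes through Q.
  two≡0⇒on-all-tangents : two ≡ 0# → ∀ {Q s t s′ t′} → det s t s′ t′ ≢ 0# →
    Q I tangentAt s t → Q I tangentAt s′ t′ → ∀ x y → Q I tangentAt x y
  two≡0⇒on-all-tangents two≡0 {⟨ q₀ , q₁ , q₂ ⟩} {s} {t} {s′} {t′} d≢0 Q∈T Q∈T′ x y = ≡-up-to-zero
    (solve 5 (λ q₀ q₁ q₂ x y → Sym.dot Sym.⟨ q₀ , q₁ , q₂ ⟩ (Sym.tangentAt x y)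
                               ⊜ κ 0 ⊕ ((y ⊗ y) ⊗ q₀ ⊕ ⊝ (q₁ ⊗ x ⊗ y) ⊗ κ 2 ⊕ (x ⊗ x) ⊗ q₂)) refl q₀ q₁ q₂ x y)
    (+-≡0 (+-≡0 (*-≡0 _ q₀≡0) (*-≡0 _ two≡0)) (*-≡0 _ q₂≡0))
    where
    q₀≡0 : q₀ ≡ 0#
    q₀≡0 = cancel-square d≢0 (≡-up-to-zero (solve 7 (λ q₀ q₁ q₂ s t s′ t′ →
      let Q = Sym.⟨ q₀ , q₁ , q₂ ⟩ ; d = Sym.det s t s′ t′ in
      (d ⊗ d) ⊗ q₀ ⊜ κ 0 ⊕ ((s′ ⊗ s′) ⊗ Sym.dot Q (Sym.tangentAt s t) ⊕ ⊝ (s ⊗ s) ⊗ Sym.dot Q (Sym.tangentAt s′ t′)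
                            ⊕ (q₀ ⊗ d ⊗ s ⊗ t′ ⊕ ⊝ (q₁ ⊗ s ⊗ s′ ⊗ d)) ⊗ κ 2)) refl q₀ q₁ q₂ s t s′ t′)
      (+-≡0 (+-≡0 (*-≡0 _ Q∈T) (*-≡0 _ Q∈T′)) (*-≡0 _ two≡0)))
    q₂≡0 : q₂ ≡ 0#
    q₂≡0 = cancel-square d≢0 (≡-up-to-zero (solve 7 (λ q₀ q₁ q₂ s t s′ t′ →
      let Q = Sym.⟨ q₀ , q₁ , q₂ ⟩ ; d = Sym.det s t s′ t′ in
      (d ⊗ d) ⊗ q₂ ⊜ κ 0 ⊕ ((t′ ⊗ t′) ⊗ Sym.dot Q (Sym.tangentAt s t) ⊕ ⊝ (t ⊗ t) ⊗ Sym.dot Q (Sym.tangentAt s′ t′)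
                            ⊕ (q₁ ⊗ t ⊗ t′ ⊗ d ⊕ ⊝ (q₂ ⊗ d ⊗ s′ ⊗ t)) ⊗ κ 2)) refl q₀ q₁ q₂ s t s′ t′)
      (+-≡0 (+-≡0 (*-≡0 _ Q∈T) (*-≡0 _ Q∈T′)) (*-≡0 _ two≡0)))

  -- A third tangent through Q is the one at (s + s′ : t + t′).
  External⇒two≢0 : ∀ {Q} → External Q → two ≢ 0#
  External⇒two≢0 (_ , u , v , u≢0 , v≢0 , u≁v , (u-tangent , Q∈u) , (v-tangent , Q∈v) , only-u-v) two≡0
    with Tangent⇒tangentAt u≢0 u-tangent | Tangent⇒tangentAt v≢0 v-tangent
  ... | s , t , st≢0 , u∼ | s′ , t′ , st′≢0 , v∼ =
    third-tangent (only-u-v T (tangentAt-NonZero xy≢0)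
      (tangentAt-Tangent xy≢0 , two≡0⇒on-all-tangents two≡0 d≢0 (I-∼ u∼ Q∈u) (I-∼ v∼ Q∈v) x y))
    where
    d≢0 : det s t s′ t′ ≢ 0#
    d≢0 = ≁⇒det≢0 st≢0 st′≢0 u∼ v∼ u≁v
    x = s + s′
    y = t + t′
    T = tangentAt x y
    xy≢0 : NonZero₂ x y
    xy≢0 (x≡0 , y≡0) = d≢0 (≡-up-to-zero (solve 4 (λ s t s′ t′ →
      Sym.det s t s′ t′ ⊜ κ 0 ⊕ (t′ ⊗ (s ⊕ s′) ⊕ ⊝ s′ ⊗ (t ⊕ t′))) refl s t s′ t′) (+-≡0 (*-≡0 _ x≡0) (*-≡0 _ y≡0)))
    third-tangent : ¬ (T ∼ u ⊎ T ∼ v)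
    third-tangent (inj₁ T∼u) = d≢0 (≡-up-to-zero
      (solve 4 (λ s t s′ t′ → Sym.det s t s′ t′ ⊜ κ 0 ⊕ ⊝ κ 1 ⊗ Sym.det (s ⊕ s′) (t ⊕ t′) s t) refl s t s′ t′)
      (*-≡0 _ (tangentAt∼⇒det≡0 (∼-trans T∼u u∼))))
    third-tangent (inj₂ T∼v) = d≢0 (≡-up-to-zero
      (solve 4 (λ s t s′ t′ → Sym.det s t s′ t′ ⊜ κ 0 ⊕ κ 1 ⊗ Sym.det (s ⊕ s′) (t ⊕ t′) s′ t′) refl s t s′ t′)
      (*-≡0 _ (tangentAt∼⇒det≡0 (∼-trans T∼v v∼))))

  IsSquare : Carrier → Set
  IsSquare a = Σ Carrier λ y → y * y ≡ a

  isSquare? : ∀ a → Dec (IsSquare a)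
  isSquare? a with Fin.any? (λ i → (element i * element i) ≟ a)
  ... | yes (i , e) = yes (element i , e)
  ... | no ¬root    = no λ (y , e) → ¬root (position y , trans (cong (λ z → z * z) (element∘position y)) e)

  IsSquare-* : ∀ {a b} → IsSquare a → IsSquare b → IsSquare (a * b)
  IsSquare-* {a} {b} (x , refl) (y , refl) = x * y , solve 2 (λ x y → (x ⊗ y) ⊗ (x ⊗ y) ⊜ (x ⊗ x) ⊗ (y ⊗ y)) refl x y

  x*x≡y*y⇒x≡±y : ∀ {x y} → x * x ≡ y * y → x ≡ y ⊎ x ≡ - y
  x*x≡y*y⇒x≡±y {x} {y} e with *-integral (x + - y) (x + y)
    (≡-up-to-zero (solve 2 (λ x y → (x ⊕ ⊝ y) ⊗ (x ⊕ y) ⊜ κ 0 ⊕ (x ⊗ x ⊕ ⊝ (y ⊗ y))) refl x y) (x≡y⇒x-y≡0 e))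
  ... | inj₁ x-y≡0 = inj₁ (x-y≡0⇒x≡y x-y≡0)
  ... | inj₂ x+y≡0 = inj₂ (≡-up-to-zero (solve 2 (λ x y → x ⊜ ⊝ y ⊕ (x ⊕ y)) refl x y) x+y≡0)

  -- For a non-square a, the map sending x to x² or a·x², according to which of ±x comes
  -- first in the enumeration of the field, is injective and hence onto.
  module _ {a} (a-nonsquare : ¬ IsSquare a) where
    private
      index : Carrier → ℕ
      index x = toℕ (position x)

      First : Carrier → Set
      First x = index x ℕ.< index (- x)

      φ : Carrier → Carrier
      φ x with index x ℕ.<? index (- x)
      ... | yes _ = x * x
      ... | no  _ = a * (x * x)

      φ-cases : ∀ x → (First x × φ x ≡ x * x) ⊎ (¬ First x × φ x ≡ a * (x * x))
      φ-cases x with index x ℕ.<? index (- x)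
      ... | yes first = inj₁ (first , refl)
      ... | no  later = inj₂ (later , refl)

      index-injective : ∀ {x y} → index x ≡ index y → x ≡ y
      index-injective {x} {y} e =
        trans (sym (element∘position x)) (trans (cong element (Fin.toℕ-injective e)) (element∘position y))

      index-neg : ∀ {x y} → x ≡ - y → index (- x) ≡ index y
      index-neg {y = y} refl = cong index (solve 1 (λ y → ⊝ (⊝ y) ⊜ y) refl y)

      a≢0 : a ≢ 0#
      a≢0 a≡0 = a-nonsquare (0# , trans (zeroˡ 0#) (sym a≡0))

      x*x≡a*y*y⇒x≡y : ∀ {x y} → x * x ≡ a * (y * y) → x ≡ y
      x*x≡a*y*y⇒x≡y {x} {y} e with y ≟ 0#
      ... | yes y≡0 = trans (x*x≡0⇒x≡0 (trans e (*-≡0 a (*-≡0 y y≡0)))) (sym y≡0)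
      ... | no  y≢0 = ⊥-elim (a-nonsquare (x * inv y≢0 , sym (≡-up-to-zero
        (solve 4 (λ a x y i → a ⊜ (x ⊗ i) ⊗ (x ⊗ i) ⊕
           (⊝ a ⊗ (y ⊗ i ⊕ κ 1) ⊗ (y ⊗ i ⊕ ⊝ κ 1) ⊕ (i ⊗ i) ⊗ (a ⊗ (y ⊗ y) ⊕ ⊝ (x ⊗ x)))) refl a x y (inv y≢0))
        (+-≡0 (*-≡0 _ (x*inv-1≡0 y≢0)) (*-≡0 _ (x≡y⇒x-y≡0 (sym e)))))))

      a*-cancel : ∀ {x y} → a * x ≡ a * y → x ≡ y
      a*-cancel {x} {y} e with *-integral a (x + - y)
        (≡-up-to-zero (solve 3 (λ a x y → a ⊗ (x ⊕ ⊝ y) ⊜ κ 0 ⊕ (a ⊗ x ⊕ ⊝ (a ⊗ y))) refl a x y) (x≡y⇒x-y≡0 e))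
      ... | inj₁ a≡0   = ⊥-elim (a≢0 a≡0)
      ... | inj₂ x-y≡0 = x-y≡0⇒x≡y x-y≡0

      φ-injective : ∀ {x y} → φ x ≡ φ y → x ≡ y
      φ-injective {x} {y} e with φ-cases x | φ-cases y
      ... | inj₁ (_ , φx) | inj₂ (_ , φy) = x*x≡a*y*y⇒x≡y (trans (sym φx) (trans e φy))
      ... | inj₂ (_ , φx) | inj₁ (_ , φy) = sym (x*x≡a*y*y⇒x≡y (trans (sym φy) (trans (sym e) φx)))
      ... | inj₁ (x-first , φx) | inj₁ (y-first , φy) with x*x≡y*y⇒x≡±y (trans (sym φx) (trans e φy))
      ...   | inj₁ x≡y  = x≡y
      ...   | inj₂ x≡-y = ⊥-elim (ℕ.<-asym (subst (index x ℕ.<_) (index-neg x≡-y) x-first)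
                                           (subst (index y ℕ.<_) (cong index (sym x≡-y)) y-first))
      φ-injective {x} {y} e | inj₂ (x-later , φx) | inj₂ (y-later , φy)
        with x*x≡y*y⇒x≡±y (a*-cancel (trans (sym φx) (trans e φy)))
      ...   | inj₁ x≡y  = x≡y
      ...   | inj₂ x≡-y = index-injective (ℕ.≤-antisym
              (ℕ.≮⇒≥ (λ y<x → y-later (subst (index y ℕ.<_) (cong index x≡-y) y<x)))
              (ℕ.≮⇒≥ (λ x<y → x-later (subst (index x ℕ.<_) (sym (index-neg x≡-y)) x<y))))

      φ-on-positions-injective : ∀ {i j} → position (φ (element i)) ≡ position (φ (element j)) → i ≡ j
      φ-on-positions-injective {i} {j} e = trans (sym (position∘element i)) (trans (cong position (φ-injective
        (trans (sym (element∘position _)) (trans (cong element e) (element∘position _))))) (position∘element j))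

      φ-surjective : ∀ b → Σ Carrier λ x → φ x ≡ b
      φ-surjective b with Fin-injective⇒surjective (λ i → position (φ (element i))) φ-on-positions-injective (position b)
      ... | i , e = element i , trans (sym (element∘position _)) (trans (cong element e) (element∘position b))

    nonsquare*nonsquare : ∀ {b} → ¬ IsSquare b → IsSquare (a * b)
    nonsquare*nonsquare {b} b-nonsquare with φ-surjective b
    ... | x , φx≡b with φ-cases x
    ...   | inj₁ (_ , φx) = ⊥-elim (b-nonsquare (x , trans (sym φx) φx≡b))
    ...   | inj₂ (_ , φx) = a * x , trans (solve 2 (λ a x → (a ⊗ x) ⊗ (a ⊗ x) ⊜ a ⊗ (a ⊗ (x ⊗ x))) refl a x)
                                        (cong (a *_) (trans (sym φx) φx≡b))

  -- A root (s : t) of m₀x² + m₁xy + m₂y² gives Δ = ((2m₀s + m₁t)/t)², or ((2m₂t + m₁s)/s)².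
  I-conicPoint⇒IsSquare-Δ : ∀ {s t m} → NonZero₂ s t → conicPoint s t I m → IsSquare (Δ m)
  I-conicPoint⇒IsSquare-Δ {s} {t} {⟨ m₀ , m₁ , m₂ ⟩} st≢0 E with t ≟ 0# | s ≟ 0#
  ... | no t≢0 | _ = (two * m₀ * s + m₁ * t) * i , sym (≡-up-to-zero (solve 6 (λ s t m₀ m₁ m₂ i →
        let m = Sym.⟨ m₀ , m₁ , m₂ ⟩ ; r = (κ 2 ⊗ m₀ ⊗ s ⊕ m₁ ⊗ t) ⊗ i in
        Sym.Δ m ⊜ r ⊗ r ⊕ (⊝ Sym.Δ m ⊗ (t ⊗ i ⊕ κ 1) ⊗ (t ⊗ i ⊕ ⊝ κ 1) ⊕ ⊝ (κ 4 ⊗ m₀ ⊗ i ⊗ i) ⊗ Sym.dot (Sym.conicPoint s t) m))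
        refl s t m₀ m₁ m₂ i) (+-≡0 (*-≡0 _ (x*inv-1≡0 t≢0)) (*-≡0 _ E)))
    where i = inv t≢0
  ... | yes _ | no s≢0 = (two * m₂ * t + m₁ * s) * i , sym (≡-up-to-zero (solve 6 (λ s t m₀ m₁ m₂ i →
        let m = Sym.⟨ m₀ , m₁ , m₂ ⟩ ; r = (κ 2 ⊗ m₂ ⊗ t ⊕ m₁ ⊗ s) ⊗ i in
        Sym.Δ m ⊜ r ⊗ r ⊕ (⊝ Sym.Δ m ⊗ (s ⊗ i ⊕ κ 1) ⊗ (s ⊗ i ⊕ ⊝ κ 1) ⊕ ⊝ (κ 4 ⊗ m₂ ⊗ i ⊗ i) ⊗ Sym.dot (Sym.conicPoint s t) m))
        refl s t m₀ m₁ m₂ i) (+-≡0 (*-≡0 _ (x*inv-1≡0 s≢0)) (*-≡0 _ E)))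
    where i = inv s≢0
  ... | yes t≡0 | yes s≡0 = ⊥-elim (st≢0 (s≡0 , t≡0))

  OnConic-I⇒IsSquare-Δ : ∀ {w m} → OnConic w → w I m → IsSquare (Δ m)
  OnConic-I⇒IsSquare-Δ w∈𝒪 wIm with OnConic⇒conicPoint w∈𝒪
  ... | s , t , st≢0 , w∼ = I-conicPoint⇒IsSquare-Δ st≢0 (∼-I w∼ wIm)

  two-points⇒Secant : ∀ {m} s t s′ t′ → NonZero₂ s t → NonZero₂ s′ t′ → det s t s′ t′ ≢ 0# →
    conicPoint s t I m → conicPoint s′ t′ I m →
    (∀ x y → conicPoint x y I m → det x y s t ≡ 0# ⊎ det x y s′ t′ ≡ 0#) → Secant m
  two-points⇒Secant {m} s t s′ t′ st≢0 st′≢0 d≢0 on on′ only =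
    conicPoint s t , conicPoint s′ t′ , conicPoint-NonZero st≢0 , conicPoint-NonZero st′≢0 ,
    (λ r → d≢0 (conicPoint∼⇒det≡0 r)) , (conicPoint-OnConic st≢0 , on) , (conicPoint-OnConic st′≢0 , on′) , unique
    where
    unique : ∀ w → NonZero w → OnConic w × w I m → w ∼ conicPoint s t ⊎ w ∼ conicPoint s′ t′
    unique w _ (w∈𝒪 , wIm) with OnConic⇒conicPoint w∈𝒪
    ... | x , y , xy≢0 , w∼ with only x y (∼-I w∼ wIm)
    ...   | inj₁ d≡0 = inj₁ (∼-trans w∼ (det≡0⇒conicPoint∼ d≡0 xy≢0 st≢0))
    ...   | inj₂ d≡0 = inj₂ (∼-trans w∼ (det≡0⇒conicPoint∼ d≡0 xy≢0 st′≢0))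

  -- With Δ = r², r ≠ 0, the two roots are (−m₁ ± r : 2m₀), or (1 : 0) and (−m₂ : m₁) when m₀ = 0.
  Δ≡r²⇒Secant : two ≢ 0# → ∀ {m r} → Δ m ≡ r * r → r ≢ 0# → Secant m
  Δ≡r²⇒Secant two≢0 {⟨ m₀ , m₁ , m₂ ⟩} {r} Δ≡r² r≢0 with m₀ ≟ 0#
  ... | no m₀≢0 = two-points⇒Secant (- m₁ + r) (two * m₀) (- m₁ + - r) (two * m₀)
        (λ z → 2m₀≢0 (proj₂ z)) (λ z → 2m₀≢0 (proj₂ z))
        distinct
        (≡-up-to-zero (solve 4 (λ m₀ m₁ m₂ r → let m = Sym.⟨ m₀ , m₁ , m₂ ⟩ in
          Sym.dot (Sym.conicPoint (⊝ m₁ ⊕ r) (κ 2 ⊗ m₀)) m ⊜ κ 0 ⊕ ⊝ m₀ ⊗ (Sym.Δ m ⊕ ⊝ (r ⊗ r))) refl m₀ m₁ m₂ r)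
          (*-≡0 _ Δ-r²≡0))
        (≡-up-to-zero (solve 4 (λ m₀ m₁ m₂ r → let m = Sym.⟨ m₀ , m₁ , m₂ ⟩ in
          Sym.dot (Sym.conicPoint (⊝ m₁ ⊕ ⊝ r) (κ 2 ⊗ m₀)) m ⊜ κ 0 ⊕ ⊝ m₀ ⊗ (Sym.Δ m ⊕ ⊝ (r ⊗ r))) refl m₀ m₁ m₂ r)
          (*-≡0 _ Δ-r²≡0))
        (λ x y E → *-integral _ _ (≡-up-to-zero (solve 6 (λ x y m₀ m₁ m₂ r → let m = Sym.⟨ m₀ , m₁ , m₂ ⟩ in
          Sym.det x y (⊝ m₁ ⊕ r) (κ 2 ⊗ m₀) ⊗ Sym.det x y (⊝ m₁ ⊕ ⊝ r) (κ 2 ⊗ m₀) ⊜ κ 0 ⊕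
            ((κ 4 ⊗ m₀) ⊗ Sym.dot (Sym.conicPoint x y) m ⊕ (y ⊗ y) ⊗ (Sym.Δ m ⊕ ⊝ (r ⊗ r))))
          refl x y m₀ m₁ m₂ r) (+-≡0 (*-≡0 _ E) (*-≡0 _ Δ-r²≡0))))
    where
    Δ-r²≡0 : Δ ⟨ m₀ , m₁ , m₂ ⟩ + - (r * r) ≡ 0#
    Δ-r²≡0 = x≡y⇒x-y≡0 Δ≡r²
    2m₀≢0 : two * m₀ ≢ 0#
    2m₀≢0 = *-nonzero two≢0 m₀≢0
    distinct : det (- m₁ + r) (two * m₀) (- m₁ + - r) (two * m₀) ≢ 0#
    distinct d≡0 = *-nonzero two≢0 2m₀r≢0 (trans (sym (solve 3 (λ m₀ m₁ r →
      Sym.det (⊝ m₁ ⊕ r) (κ 2 ⊗ m₀) (⊝ m₁ ⊕ ⊝ r) (κ 2 ⊗ m₀) ⊜ κ 2 ⊗ (κ 2 ⊗ m₀ ⊗ r)) refl m₀ m₁ r)) d≡0)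
      where 2m₀r≢0 = *-nonzero 2m₀≢0 r≢0
  ... | yes m₀≡0 = two-points⇒Secant 1# 0# (- m₂) m₁ (λ z → 1≢0 (proj₁ z)) (λ z → m₁≢0 (proj₂ z))
        (λ d≡0 → m₁≢0 (trans (sym (solve 2 (λ m₁ m₂ → Sym.det (κ 1) (κ 0) (⊝ m₂) m₁ ⊜ m₁) refl m₁ m₂)) d≡0))
        (trans (solve 3 (λ m₀ m₁ m₂ → Sym.dot (Sym.conicPoint (κ 1) (κ 0)) Sym.⟨ m₀ , m₁ , m₂ ⟩ ⊜ m₀) refl m₀ m₁ m₂) m₀≡0)
        (≡-up-to-zero (solve 3 (λ m₀ m₁ m₂ →
          Sym.dot (Sym.conicPoint (⊝ m₂) m₁) Sym.⟨ m₀ , m₁ , m₂ ⟩ ⊜ κ 0 ⊕ (m₂ ⊗ m₂) ⊗ m₀) refl m₀ m₁ m₂) (*-≡0 _ m₀≡0))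
        (λ x y E → *-integral _ _ (≡-up-to-zero (solve 5 (λ x y m₀ m₁ m₂ →
          Sym.det x y (κ 1) (κ 0) ⊗ Sym.det x y (⊝ m₂) m₁ ⊜ κ 0 ⊕
            (⊝ κ 1 ⊗ Sym.dot (Sym.conicPoint x y) Sym.⟨ m₀ , m₁ , m₂ ⟩ ⊕ (x ⊗ x) ⊗ m₀)) refl x y m₀ m₁ m₂)
          (+-≡0 (*-≡0 _ E) (*-≡0 _ m₀≡0))))
    where
    m₁≢0 : m₁ ≢ 0#
    m₁≢0 m₁≡0 = r≢0 (x*x≡0⇒x≡0 (trans (sym Δ≡r²) (≡-up-to-zero (solve 3 (λ m₀ m₁ m₂ →
      Sym.Δ Sym.⟨ m₀ , m₁ , m₂ ⟩ ⊜ κ 0 ⊕ (m₁ ⊗ m₁ ⊕ ⊝ (κ 4 ⊗ m₂) ⊗ m₀)) refl m₀ m₁ m₂) (+-≡0 (*-≡0 _ m₁≡0) (*-≡0 _ m₀≡0)))))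

  infix 4 _≃²_
  _≃²_ : Carrier → Carrier → Set
  x ≃² y = Σ Carrier λ k → k ≢ 0# × y ≡ (k * k) * x

  ≃²-sym : ∀ {x y} → x ≃² y → y ≃² x
  ≃²-sym {x} {y} (k , k≢0 , y≡k²x) = inv k≢0 , inv≢0 k≢0 , ≡-up-to-zero
    (solve 4 (λ x y k i → x ⊜ (i ⊗ i) ⊗ y ⊕ (⊝ x ⊗ (k ⊗ i ⊕ κ 1) ⊗ (k ⊗ i ⊕ ⊝ κ 1) ⊕ ⊝ (i ⊗ i) ⊗ (y ⊕ ⊝ ((k ⊗ k) ⊗ x))))
      refl x y k (inv k≢0))
    (+-≡0 (*-≡0 _ (x*inv-1≡0 k≢0)) (*-≡0 _ (x≡y⇒x-y≡0 y≡k²x)))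

  ≃²-trans : ∀ {x y z} → x ≃² y → y ≃² z → x ≃² z
  ≃²-trans {x} (k , k≢0 , y≡k²x) (k′ , k′≢0 , z≡k′²y) = k′ * k , *-nonzero k′≢0 k≢0 ,
    trans z≡k′²y (trans (cong ((k′ * k′) *_) y≡k²x)
      (solve 3 (λ x k k′ → (k′ ⊗ k′) ⊗ ((k ⊗ k) ⊗ x) ⊜ ((k′ ⊗ k) ⊗ (k′ ⊗ k)) ⊗ x) refl x k k′))

  ≃²-IsSquare : ∀ {x y} → x ≃² y → IsSquare x → IsSquare y
  ≃²-IsSquare (k , _ , y≡k²x) (r , r²≡x) = k * r ,
    trans (solve 2 (λ k r → (k ⊗ r) ⊗ (k ⊗ r) ⊜ (k ⊗ k) ⊗ (r ⊗ r)) refl k r) (trans (cong ((k * k) *_) r²≡x) (sym y≡k²x))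

  ≃²-≢0 : ∀ {x y} → x ≃² y → x ≢ 0# → y ≢ 0#
  ≃²-≢0 (k , k≢0 , y≡k²x) x≢0 y≡0 = *-nonzero (*-nonzero k≢0 k≢0) x≢0 (trans (sym y≡k²x) y≡0)

  Secant⇒¬Passant : ∀ {m} → Secant m → ¬ Passant m
  Secant⇒¬Passant (u , _ , u≢0 , _ , _ , u∈𝒪∩m , _) m-passant = m-passant u u≢0 u∈𝒪∩m

  module _ {m a} (Δ≃²a : Δ m ≃² a) where
    Secant⇒IsSquare : Secant m → IsSquare a
    Secant⇒IsSquare (u , _ , _ , _ , _ , (u∈𝒪 , uIm) , _) = ≃²-IsSquare Δ≃²a (OnConic-I⇒IsSquare-Δ u∈𝒪 uIm)

    ¬IsSquare⇒Passant : ¬ IsSquare a → Passant m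
    ¬IsSquare⇒Passant ¬□a w _ (w∈𝒪 , wIm) = ¬□a (≃²-IsSquare Δ≃²a (OnConic-I⇒IsSquare-Δ w∈𝒪 wIm))

    module _ (two≢0 : two ≢ 0#) (a≢0 : a ≢ 0#) where
      IsSquare⇒Secant : IsSquare a → Secant m
      IsSquare⇒Secant □a = Δ≡r²⇒Secant two≢0 (sym r²≡Δ) (λ r≡0 → Δ≢0 (trans (sym r²≡Δ) (*-≡0 r r≡0)))
        where
        a≃²Δ : a ≃² Δ m
        a≃²Δ = ≃²-sym Δ≃²a
        r : Carrier
        r = proj₁ (≃²-IsSquare a≃²Δ □a)
        r²≡Δ : r * r ≡ Δ m
        r²≡Δ = proj₂ (≃²-IsSquare a≃²Δ □a)
        Δ≢0 : Δ m ≢ 0#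
        Δ≢0 = ≃²-≢0 a≃²Δ a≢0

      Passant⇒¬IsSquare : Passant m → ¬ IsSquare a
      Passant⇒¬IsSquare m-passant □a = Secant⇒¬Passant (IsSquare⇒Secant □a) m-passant

  SameSquareClass : Carrier → Carrier → Set
  SameSquareClass x y = (IsSquare x × IsSquare y) ⊎ (¬ IsSquare x × ¬ IsSquare y)

  square-product-parity : ∀ {a b c} → a ≢ 0# → b ≢ 0# → c ≢ 0# →
    IsSquare (b * c) ⇔ SameSquareClass (a * b) (a * c)
  square-product-parity {a} {b} {c} a≢0 b≢0 c≢0 = mk⇔ square⇒same same⇒square
    where
    abbc≃²ac : (a * b) * (b * c) ≃² a * c
    abbc≃²ac = ≃²-sym (b , b≢0 , solve 3 (λ a b c → (a ⊗ b) ⊗ (b ⊗ c) ⊜ (b ⊗ b) ⊗ (a ⊗ c)) refl a b c)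
    acbc≃²ab : (a * c) * (b * c) ≃² a * b
    acbc≃²ab = ≃²-sym (c , c≢0 , solve 3 (λ a b c → (a ⊗ c) ⊗ (b ⊗ c) ⊜ (c ⊗ c) ⊗ (a ⊗ b)) refl a b c)
    abac≃²bc : (a * b) * (a * c) ≃² b * c
    abac≃²bc = ≃²-sym (a , a≢0 , solve 3 (λ a b c → (a ⊗ b) ⊗ (a ⊗ c) ⊜ (a ⊗ a) ⊗ (b ⊗ c)) refl a b c)
    square⇒same : IsSquare (b * c) → SameSquareClass (a * b) (a * c)
    square⇒same □bc with isSquare? (a * b)
    ... | yes □ab = inj₁ (□ab , ≃²-IsSquare abbc≃²ac (IsSquare-* □ab □bc))
    ... | no ¬□ab = inj₂ (¬□ab , λ □ac → ¬□ab (≃²-IsSquare acbc≃²ab (IsSquare-* □ac □bc)))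
    same⇒square : SameSquareClass (a * b) (a * c) → IsSquare (b * c)
    same⇒square (inj₁ (□ab , □ac))   = ≃²-IsSquare abac≃²bc (IsSquare-* □ab □ac)
    same⇒square (inj₂ (¬□ab , ¬□ac)) = ≃²-IsSquare abac≃²bc (nonsquare*nonsquare ¬□ab ¬□ac)

  both-passant-or-both-secant⇔SameSquareClass : two ≢ 0# → ∀ {m m′ a a′} →
    Δ m ≃² a → Δ m′ ≃² a′ → a ≢ 0# → a′ ≢ 0# →
    ((Passant m × Passant m′) ⊎ (Secant m × Secant m′)) ⇔ SameSquareClass a a′
  both-passant-or-both-secant⇔SameSquareClass two≢0 Δm≃²a Δm′≃²a′ a≢0 a′≢0 = mk⇔
    (λ { (inj₁ (p , p′)) → inj₂ (Passant⇒¬IsSquare Δm≃²a two≢0 a≢0 p , Passant⇒¬IsSquare Δm′≃²a′ two≢0 a′≢0 p′)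
       ; (inj₂ (s , s′)) → inj₁ (Secant⇒IsSquare Δm≃²a s , Secant⇒IsSquare Δm′≃²a′ s′) })
    (λ { (inj₁ (□a , □a′)) → inj₂ (IsSquare⇒Secant Δm≃²a two≢0 a≢0 □a , IsSquare⇒Secant Δm′≃²a′ two≢0 a′≢0 □a′)
       ; (inj₂ (¬□a , ¬□a′)) → inj₁ (¬IsSquare⇒Passant Δm≃²a ¬□a , ¬IsSquare⇒Passant Δm′≃²a′ ¬□a′) })

  Δ-∼ : ∀ {u v} → u ∼ v → Δ u ≃² Δ v
  Δ-∼ {⟨ a , b , c ⟩} (k , k≢0 , refl , refl , refl) = k , k≢0 ,
    solve 4 (λ a b c k → Sym.Δ (Sym.scale k Sym.⟨ a , b , c ⟩) ⊜ (k ⊗ k) ⊗ Sym.Δ Sym.⟨ a , b , c ⟩) refl a b c k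

  conicForm-∼ : ∀ {u v} → u ∼ v → conicForm u ≃² conicForm v
  conicForm-∼ {⟨ a , b , c ⟩} (k , k≢0 , refl , refl , refl) = k , k≢0 ,
    solve 4 (λ a b c k → Sym.conicForm (Sym.scale k Sym.⟨ a , b , c ⟩) ⊜ (k ⊗ k) ⊗ Sym.conicForm Sym.⟨ a , b , c ⟩)
      refl a b c k

  conicForm-conicPoint : ∀ x y → conicForm (conicPoint x y) ≡ 0#
  conicForm-conicPoint x y = solve 2 (λ x y → Sym.conicForm (Sym.conicPoint x y) ⊜ κ 0) refl x y

  Δ≢0⇒NonZero : ∀ {u} → Δ u ≢ 0# → NonZero u
  Δ≢0⇒NonZero Δ≢0 u≡0 = Δ≢0 (IsZero⇒Δ≡0 u≡0)

  Internal⇒dot-tangentAt≢0 : ∀ {P s t} → Internal P → NonZero₂ s t → dot P (tangentAt s t) ≢ 0#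
  Internal⇒dot-tangentAt≢0 {s = s} {t} (_ , no-tangent) st≢0 PIT =
    no-tangent (tangentAt s t) (tangentAt-NonZero st≢0) (tangentAt-Tangent st≢0 , PIT)

  Δ-join-meet-of-tangents : ∀ P s t s′ t′ →
    Δ (join P (join (tangentAt s t) (tangentAt s′ t′)))
      ≡ (dot P (tangentAt s t) * dot P (tangentAt s′ t′)) * ((two * det s t s′ t′) * (two * det s t s′ t′))
  Δ-join-meet-of-tangents ⟨ p₀ , p₁ , p₂ ⟩ s t s′ t′ = solve 7 (λ p₀ p₁ p₂ s t s′ t′ →
    let P = Sym.⟨ p₀ , p₁ , p₂ ⟩ ; T = Sym.tangentAt s t ; T′ = Sym.tangentAt s′ t′ ; d = Sym.det s t s′ t′ in
    Sym.Δ (Sym.join P (Sym.join T T′)) ⊜ (Sym.dot P T ⊗ Sym.dot P T′) ⊗ ((κ 2 ⊗ d) ⊗ (κ 2 ⊗ d)))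
    refl p₀ p₁ p₂ s t s′ t′

  join-meet-of-tangents-class : two ≢ 0# → ∀ P {s t s′ t′} → det s t s′ t′ ≢ 0# →
    Δ (join P (join (tangentAt s t) (tangentAt s′ t′))) ≃² dot P (tangentAt s t) * dot P (tangentAt s′ t′)
  join-meet-of-tangents-class two≢0 P {s} {t} {s′} {t′} d≢0 = ≃²-sym (two * det s t s′ t′ , *-nonzero two≢0 d≢0 ,
    trans (Δ-join-meet-of-tangents P s t s′ t′) (*-comm _ _))

  dot-meet-of-tangents : ∀ s t s′ t′ x y →
    dot (join (tangentAt s t) (tangentAt s′ t′)) (tangentAt x y) ≡ det s t s′ t′ * (two * (det s t x y * det s′ t′ x y))
  dot-meet-of-tangents s t s′ t′ x y = solve 6 (λ s t s′ t′ x y →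
    Sym.dot (Sym.join (Sym.tangentAt s t) (Sym.tangentAt s′ t′)) (Sym.tangentAt x y)
      ⊜ Sym.det s t s′ t′ ⊗ (κ 2 ⊗ (Sym.det s t x y ⊗ Sym.det s′ t′ x y))) refl s t s′ t′ x y

  tangent-through-meet⇒det≡0 : two ≢ 0# → ∀ {s t s′ t′ x y} → det s t s′ t′ ≢ 0# →
    join (tangentAt s t) (tangentAt s′ t′) I tangentAt x y → det s t x y ≡ 0# ⊎ det s′ t′ x y ≡ 0#
  tangent-through-meet⇒det≡0 two≢0 {s} {t} {s′} {t′} {x} {y} d≢0 MIT
    with *-integral (det s t s′ t′) _ (trans (sym (dot-meet-of-tangents s t s′ t′ x y)) MIT)
  ... | inj₁ d≡0 = ⊥-elim (d≢0 d≡0)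
  ... | inj₂ 2dd≡0 with *-integral two _ 2dd≡0
  ...   | inj₁ two≡0 = ⊥-elim (two≢0 two≡0)
  ...   | inj₂ dd≡0  = *-integral _ _ dd≡0

  meet-of-tangents-External : two ≢ 0# → ∀ {s t s′ t′} → NonZero₂ s t → NonZero₂ s′ t′ → det s t s′ t′ ≢ 0# →
                              External (join (tangentAt s t) (tangentAt s′ t′))
  meet-of-tangents-External two≢0 {s} {t} {s′} {t′} st≢0 st′≢0 d≢0 =
    off-conic , T , T′ , tangentAt-NonZero st≢0 , tangentAt-NonZero st′≢0 , T≁T′ ,
    (tangentAt-Tangent st≢0 , I-sym {T} {M} (I-joinˡ T T′)) , (tangentAt-Tangent st′≢0 , I-sym {T′} {M} (I-joinʳ T T′)) ,
    only-T-T′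
    where
    T  = tangentAt s t
    T′ = tangentAt s′ t′
    M  = join T T′
    T≁T′ : ¬ T ∼ T′
    T≁T′ r = d≢0 (tangentAt∼⇒det≡0 r)
    off-conic : ¬ OnConic M
    off-conic M∈𝒪 with OnConic⇒conicPoint M∈𝒪
    ... | x , y , _ , M∼ = ≃²-≢0 (conicForm-∼ M∼) conicForm-M≢0 (conicForm-conicPoint x y)
      where
      conicForm-M≢0 : conicForm M ≢ 0#
      conicForm-M≢0 e = d≢0 (det⁴≡0⇒det≡0 (trans (sym (conicForm-join-tangentAt s t s′ t′)) e))
    only-T-T′ : ∀ w → NonZero w → Tangent w × M I w → w ∼ T ⊎ w ∼ T′
    only-T-T′ w w≢0 (w-tangent , MIw) with Tangent⇒tangentAt w≢0 w-tangent
    ... | x , y , xy≢0 , w∼ with tangent-through-meet⇒det≡0 two≢0 d≢0 (I-∼ w∼ MIw)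
    ...   | inj₁ d≡0 = inj₁ (∼-trans w∼ (∼-sym (det≡0⇒tangentAt∼ d≡0 st≢0 xy≢0)))
    ...   | inj₂ d≡0 = inj₂ (∼-trans w∼ (∼-sym (det≡0⇒tangentAt∼ d≡0 st′≢0 xy≢0)))

  meet-on-secant⇔IsSquare : two ≢ 0# → ∀ {P} → NonZero P → Internal P →
    ∀ {s t s′ t′} → NonZero₂ s t → NonZero₂ s′ t′ → det s t s′ t′ ≢ 0# →
    ∀ {ℓ ℓ′} → ℓ ∼ tangentAt s t → ℓ′ ∼ tangentAt s′ t′ →
    (Σ Triple λ R → NonZero R × R I ℓ × R I ℓ′ × External R ×
       Σ Triple λ m → NonZero m × Secant m × P I m × R I m)
    ⇔ IsSquare (dot P (tangentAt s t) * dot P (tangentAt s′ t′))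
  meet-on-secant⇔IsSquare two≢0 {P} P≢0 P-internal {s} {t} {s′} {t′} st≢0 st′≢0 d≢0 {ℓ} {ℓ′} ℓ∼T ℓ′∼T′ =
    mk⇔ necessary sufficient
    where
    T  = tangentAt s t
    T′ = tangentAt s′ t′
    M  = join T T′
    M≢0 : NonZero M
    M≢0 = join-tangentAt-NonZero d≢0
    PM-class : Δ (join P M) ≃² dot P T * dot P T′
    PM-class = join-meet-of-tangents-class two≢0 P d≢0
    αα′≢0 : dot P T * dot P T′ ≢ 0#
    αα′≢0 = *-nonzero (Internal⇒dot-tangentAt≢0 P-internal st≢0) (Internal⇒dot-tangentAt≢0 P-internal st′≢0)

    necessary : (Σ Triple λ R → NonZero R × R I ℓ × R I ℓ′ × External R ×
                   Σ Triple λ m → NonZero m × Secant m × P I m × R I m) →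
                IsSquare (dot P T * dot P T′)
    necessary (R , R≢0 , R∈ℓ , R∈ℓ′ , _ , m , m≢0 , m-secant , P∈m , R∈m) =
      Secant⇒IsSquare (≃²-trans (Δ-∼ m∼PR) (≃²-trans (Δ-∼ (join-congʳ P R∼M)) PM-class)) m-secant
      where
      R∈T : R I T
      R∈T = I-∼ ℓ∼T R∈ℓ
      R∼M : R ∼ M
      R∼M = I-both⇒∼join R≢0 R∈T (I-∼ ℓ′∼T′ R∈ℓ′) M≢0
      PR≢0 : NonZero (join P R)
      PR≢0 PR≡0 = Internal⇒dot-tangentAt≢0 P-internal st≢0 (∼-I (∼-sym (join≡0⇒∼ P≢0 R≢0 PR≡0)) R∈T)
      m∼PR : m ∼ join P R
      m∼PR = I-both⇒∼join m≢0 (I-sym P∈m) (I-sym R∈m) PR≢0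

    sufficient : IsSquare (dot P T * dot P T′) →
                 Σ Triple λ R → NonZero R × R I ℓ × R I ℓ′ × External R ×
                   Σ Triple λ m → NonZero m × Secant m × P I m × R I m
    sufficient □ =
      M , M≢0 , I-∼ (∼-sym ℓ∼T) (I-sym (I-joinˡ T T′)) , I-∼ (∼-sym ℓ′∼T′) (I-sym (I-joinʳ T T′)) ,
      meet-of-tangents-External two≢0 st≢0 st′≢0 d≢0 ,
      join P M , Δ≢0⇒NonZero (≃²-≢0 (≃²-sym PM-class) αα′≢0) , IsSquare⇒Secant PM-class two≢0 αα′≢0 □ ,
      I-joinˡ P M , I-joinʳ P M

  meet-on-secant⇔same-type :
      (P : Triple) → NonZero P → Internal P →
      (Q : Triple) → NonZero Q → External Q → Q I (P ⊥) →
      (ℓ* : Triple) → NonZero ℓ* → Tangent ℓ* → Q I ℓ* →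
      (P₁ P₂ : Triple) → NonZero P₁ → NonZero P₂ → ¬ (P₁ ∼ P₂) →
      External P₁ → External P₂ → P₁ I ℓ* → P₂ I ℓ* →
      (ℓ₁ ℓ₂ : Triple) → NonZero ℓ₁ → NonZero ℓ₂ →
      Tangent ℓ₁ → P₁ I ℓ₁ → ¬ (ℓ₁ ∼ ℓ*) →
      Tangent ℓ₂ → P₂ I ℓ₂ → ¬ (ℓ₂ ∼ ℓ*) →
      (Σ Triple λ R → NonZero R × R I ℓ₁ × R I ℓ₂ × External R ×
         Σ Triple λ m → NonZero m × Secant m × P I m × R I m)
      ⇔ ((Passant (join P P₁) × Passant (join P P₂)) ⊎
         (Secant (join P P₁) × Secant (join P P₂)))
  meet-on-secant⇔same-type P P≢0 P-internal Q _ Q-external _ ℓ* ℓ*≢0 ℓ*-tangent _ P₁ P₂ P₁≢0 P₂≢0 P₁≁P₂ _ _ P₁∈ℓ* P₂∈ℓ*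
                           ℓ₁ ℓ₂ ℓ₁≢0 ℓ₂≢0 ℓ₁-tangent P₁∈ℓ₁ ℓ₁≁ℓ* ℓ₂-tangent P₂∈ℓ₂ ℓ₂≁ℓ*
    with Tangent⇒tangentAt ℓ*≢0 ℓ*-tangent | Tangent⇒tangentAt ℓ₁≢0 ℓ₁-tangent | Tangent⇒tangentAt ℓ₂≢0 ℓ₂-tangent
  ... | s₀ , t₀ , st₀≢0 , ℓ*∼T₀ | s₁ , t₁ , st₁≢0 , ℓ₁∼T₁ | s₂ , t₂ , st₂≢0 , ℓ₂∼T₂ =
    ⇔-trans (meet-on-secant⇔IsSquare two≢0 P≢0 P-internal st₁≢0 st₂≢0 d₁₂≢0 ℓ₁∼T₁ ℓ₂∼T₂)
   (⇔-trans (square-product-parity (α≢0 st₀≢0) (α≢0 st₁≢0) (α≢0 st₂≢0))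
            (⇔-sym (both-passant-or-both-secant⇔SameSquareClass two≢0
                      PP₁-class PP₂-class
                      (*-nonzero (α≢0 st₀≢0) (α≢0 st₁≢0)) (*-nonzero (α≢0 st₀≢0) (α≢0 st₂≢0)))))
    where
    two≢0 : two ≢ 0#
    two≢0 = External⇒two≢0 Q-external
    α≢0 : ∀ {s t} → NonZero₂ s t → dot P (tangentAt s t) ≢ 0#
    α≢0 = Internal⇒dot-tangentAt≢0 P-internal
    d₀₁≢0 : det s₀ t₀ s₁ t₁ ≢ 0#
    d₀₁≢0 = ≁⇒det≢0 st₀≢0 st₁≢0 ℓ*∼T₀ ℓ₁∼T₁ (λ r → ℓ₁≁ℓ* (∼-sym r))
    d₀₂≢0 : det s₀ t₀ s₂ t₂ ≢ 0#
    d₀₂≢0 = ≁⇒det≢0 st₀≢0 st₂≢0 ℓ*∼T₀ ℓ₂∼T₂ (λ r → ℓ₂≁ℓ* (∼-sym r))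
    P₁∼M₁ : P₁ ∼ join (tangentAt s₀ t₀) (tangentAt s₁ t₁)
    P₁∼M₁ = I-both⇒∼join P₁≢0 (I-∼ ℓ*∼T₀ P₁∈ℓ*) (I-∼ ℓ₁∼T₁ P₁∈ℓ₁) (join-tangentAt-NonZero d₀₁≢0)
    P₂∼M₂ : P₂ ∼ join (tangentAt s₀ t₀) (tangentAt s₂ t₂)
    P₂∼M₂ = I-both⇒∼join P₂≢0 (I-∼ ℓ*∼T₀ P₂∈ℓ*) (I-∼ ℓ₂∼T₂ P₂∈ℓ₂) (join-tangentAt-NonZero d₀₂≢0)
    -- If T₁ = T₂ then P₂, like P₁, would be the meet of T₀ and T₁.
    d₁₂≢0 : det s₁ t₁ s₂ t₂ ≢ 0#
    d₁₂≢0 d≡0 = P₁≁P₂ (∼-trans P₁∼M₁ (∼-sym (I-both⇒∼join P₂≢0 (I-∼ ℓ*∼T₀ P₂∈ℓ*)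
                  (I-∼ (∼-trans ℓ₂∼T₂ (∼-sym (det≡0⇒tangentAt∼ d≡0 st₁≢0 st₂≢0))) P₂∈ℓ₂) (join-tangentAt-NonZero d₀₁≢0))))
    PP₁-class : Δ (join P P₁) ≃² dot P (tangentAt s₀ t₀) * dot P (tangentAt s₁ t₁)
    PP₁-class = ≃²-trans (Δ-∼ (join-congʳ P P₁∼M₁)) (join-meet-of-tangents-class two≢0 P d₀₁≢0)
    PP₂-class : Δ (join P P₂) ≃² dot P (tangentAt s₀ t₀) * dot P (tangentAt s₂ t₂)
    PP₂-class = ≃²-trans (Δ-∼ (join-congʳ P P₂∼M₂)) (join-meet-of-tangents-class two≢0 P d₀₂≢0)

lemma2p14 : (q : ℕ) → q % 2 ≡ 1 → (F : FiniteField q) →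
  let open PG2 F in
  (P : Triple) → NonZero P → Internal P →
  (Q : Triple) → NonZero Q → External Q → Q I (P ⊥) →
  (ℓ* : Triple) → NonZero ℓ* → Tangent ℓ* → Q I ℓ* →
  (P₁ P₂ : Triple) → NonZero P₁ → NonZero P₂ → ¬ (P₁ ∼ P₂) →
  External P₁ → External P₂ → P₁ I ℓ* → P₂ I ℓ* →
  (ℓ₁ ℓ₂ : Triple) → NonZero ℓ₁ → NonZero ℓ₂ →
  Tangent ℓ₁ → P₁ I ℓ₁ → ¬ (ℓ₁ ∼ ℓ*) →
  Tangent ℓ₂ → P₂ I ℓ₂ → ¬ (ℓ₂ ∼ ℓ*) →
  (Σ Triple λ R → NonZero R × R I ℓ₁ × R I ℓ₂ × External R ×
     Σ Triple λ m → NonZero m × Secant m × P I m × R I m)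
  ⇔ ((Passant (join P P₁) × Passant (join P P₂)) ⊎
     (Secant (join P P₁) × Secant (join P P₂)))
-- q odd is implied by the external point Q (External⇒two≢0).
lemma2p14 q _ F = Geometry.meet-on-secant⇔same-type F
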